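{- Let $E_1$ and $E_2$ be ordinary elliptic curves defined over $\mathbb{F}_q$, $q=p^r$ with $p\neq 2,3$ prime, such that $j(E_1)=j(E_2)$. Then $\#E_1(\mathbb{F}_q)=\#E_2(\mathbb{F}_q)$ if and only if $E_1(\mathbb{F}_q)\cong E_2(\mathbb{F}_q)$ as groups.
   Context: For $E:y^2=x^3+Ax+B$, the $j$-invariant is $j(E)=1728\cdot\frac{4A^3}{4A^3+27B^2}$. $E(\mathbb{F}_q)$ is the group of $\mathbb{F}_q$-rational points. $E$ is supersingular if $\#E(\mathbb{F}_q)\equiv 1\pmod p$ and ordinary otherwise. -}

module Defs where

open import Level using (0ℓ)
open import Data.Nat as ℕ using (ℕ; zero; suc; _%_)
open import Data.Nat.Primality using (Prime)
open import Data.Fin using (Fin)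
open import Data.List using (List; allFin; map)
open import Data.Nat.ListAction using (sum)
open import Data.Maybe using (Maybe; just; nothing)
open import Data.Product using (Σ; ∃; ∃-syntax; _×_; _,_; proj₁)
open import Data.Unit using (⊤)
open import Data.Empty using (⊥)
open import Relation.Nullary using (¬_; Dec; yes; no)
open import Relation.Binary.Definitions using (DecidableEquality)
open import Relation.Binary.PropositionalEquality using (_≡_)
open import Algebra.Structures using (IsCommutativeRing)
open import Function.Bundles using (_↔_; _⤖_; Bijection)

record FiniteField : Set₁ where
  infixl 7 _*_
  infixl 6 _+_ _-_
  infix 8 -_
  infix 4 _≟_
  infixl 9 _⁻¹ _^2 _^3
  field
    Carrier : Set
    _+_ _*_ : Carrier → Carrier → Carrier
    -_      : Carrier → Carrier
    0# 1#   : Carrier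
    isCommutativeRing : IsCommutativeRing _≡_ _+_ _*_ -_ 0# 1#
    _⁻¹     : Carrier → Carrier
    0≢1     : ¬ (0# ≡ 1#)
    ⁻¹-inverse : ∀ x → ¬ (x ≡ 0#) → x * (x ⁻¹) ≡ 1#
    _≟_     : DecidableEquality Carrier
    size    : ℕ
    enum    : Fin size ↔ Carrier

  _-_ : Carrier → Carrier → Carrier
  x - y = x + (- y)

  fromℕ : ℕ → Carrier
  fromℕ zero    = 0#
  fromℕ (suc n) = 1# + fromℕ n

  _^3 : Carrier → Carrier
  x ^3 = x * x * x

  _^2 : Carrier → Carrier
  x ^2 = x * x

module _ (F : FiniteField) where
  open FiniteField F

  discr : Carrier → Carrier → Carrier
  discr A B = fromℕ 4 * (A ^3) + fromℕ 27 * (B ^2)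

  record EllipticCurve : Set where
    constructor mkEC
    field
      A B : Carrier
      nonsingular : ¬ (discr A B ≡ 0#)

  open EllipticCurve

  jInvariant : EllipticCurve → Carrier
  jInvariant E = fromℕ 1728 * (fromℕ 4 * (A E ^3)) * (discr (A E) (B E) ⁻¹)

  -- raw projective points: nothing = point at infinity O, just (x , y) affine
  RawPoint : Set
  RawPoint = Maybe (Carrier × Carrier)

  OnCurve : EllipticCurve → RawPoint → Set
  OnCurve E nothing        = ⊤
  OnCurve E (just (x , y)) = y ^2 ≡ x ^3 + A E * x + B E

  Point : EllipticCurve → Set
  Point E = Σ RawPoint (OnCurve E)

  -- the chord-and-tangent group law on raw points
  -- third intersection point, reflected: slope l through (x₁,y₁),(x₂,_)
  chord : Carrier → Carrier → Carrier → Carrier → RawPoint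
  chord l x₁ y₁ x₂ = just (x₃ , l * (x₁ - x₃) - y₁)
    where x₃ = l ^2 - x₁ - x₂

  addRaw : EllipticCurve → RawPoint → RawPoint → RawPoint
  addRaw E nothing Q = Q
  addRaw E (just P) nothing = just P
  addRaw E (just (x₁ , y₁)) (just (x₂ , y₂)) with x₁ ≟ x₂ | y₁ ≟ - y₂
  ... | yes _ | yes _ = nothing
  ... | yes _ | no _  = chord ((fromℕ 3 * x₁ ^2 + A E) * (fromℕ 2 * y₁) ⁻¹) x₁ y₁ x₂
  ... | no _  | _     = chord ((y₂ - y₁) * (x₂ - x₁) ⁻¹) x₁ y₁ x₂

  indicator : EllipticCurve → Carrier → Carrier → ℕ
  indicator E x y with (y ^2) ≟ (x ^3 + A E * x + B E)
  ... | yes _ = 1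
  ... | no _  = 0

  #points : EllipticCurve → ℕ
  #points E = suc (sum (map (λ i → sum (map (λ j →
                indicator E (Inverse.to enum i) (Inverse.to enum j))
                (allFin size))) (allFin size)))
    where open Function.Bundles using (Inverse)

  Supersingular : (p : ℕ) .{{_ : ℕ.NonZero p}} → EllipticCurve → Set
  Supersingular p E = #points E % p ≡ 1 % p

  Ordinary : (p : ℕ) .{{_ : ℕ.NonZero p}} → EllipticCurve → Set
  Ordinary p E = ¬ Supersingular p E

  IsGroupHom : (E₁ E₂ : EllipticCurve) → (Point E₁ → Point E₂) → Set
  IsGroupHom E₁ E₂ φ = ∀ (P Q R : Point E₁) →
    proj₁ R ≡ addRaw E₁ (proj₁ P) (proj₁ Q) →
    proj₁ (φ R) ≡ addRaw E₂ (proj₁ (φ P)) (proj₁ (φ Q))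

  GroupIso : EllipticCurve → EllipticCurve → Set
  GroupIso E₁ E₂ = Σ (Point E₁ ⤖ Point E₂) λ φ → IsGroupHom E₁ E₂ (Bijection.to φ)

  HasOrderPrimePower : ℕ → Set
  HasOrderPrimePower p = ∃[ r ] (1 ℕ.≤ r × FiniteField.size F ≡ p ℕ.^ r)

{-# OPTIONS --safe #-}

-- Modulo p a curve y² = x³ + Ax + B over a field of q = 2m + 1 elements has 1 + H(A,B) points, where
-- H(A,B) = Σ_x (x³ + Ax + B)^m (Euler's criterion), so it is ordinary exactly when H(A,B) ≠ 0, and
-- equal point counts force equal values of H. Equal j-invariants give A₁³B₂² = A₂³B₁².
-- If A₁B₁ ≠ 0, the curves are (A,B) and (v²A,v³B), and H scales by v^{3m} = v^m; so v^m = 1 and v is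
-- a square u². If A₁ = 0 or B₁ = 0, expanding H and using that Σ_x x^k = 0 unless q − 1 divides k > 0
-- leaves at most one monomial; so H is homogeneous of degree (q − 1)/6 in B, resp. (q − 1)/4 in A, and
-- the ratio of the coefficients is a sixth, resp. fourth, power of some u.
-- In all cases (A₂,B₂) = (u⁴A₁,u⁶B₁), and (x,y) ↦ (u²x,u³y) is an isomorphism over the field itself.
module Submission where

open import Defs
open import Level using (0ℓ)
open import Algebra.Bundles using (CommutativeMonoid; CommutativeRing)
import Algebra.Properties.CommutativeMonoid.Sum
import Algebra.Properties.CommutativeSemiring.Exp
import Algebra.Properties.Group
import Algebra.Properties.Ring
import Algebra.Properties.Semiring.Sum
import Axiom.UniquenessOfIdentityProofs
open import Data.Fin using (Fin; zero; suc; punchIn)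
open import Data.Fin.Permutation using (↔⇒≡)
open import Data.Fin.Properties using (punchInᵢ≢i; any?)
open import Data.List using
  (List; []; _∷_; _++_; length; lookup; map; filter; replicate; allFin; tabulate; cartesianProduct)
open import Data.List.Properties using
  (length-++; length-replicate; length-map; length-tabulate; map-tabulate; map-∘; map-cong; filter-++)
open import Data.List.Membership.Propositional using (_∈_)
open import Data.List.Membership.Propositional.Properties
  using (∈-lookup; ∈-allFin; ∈-map⁺; ∈-map⁻; ∈-filter⁺; ∈-filter⁻; ∈-cartesianProduct⁺)
open import Data.List.Relation.Unary.All as All using (All; []; _∷_)
import Data.List.Relation.Unary.All.Properties as All
open import Data.List.Relation.Unary.Any using (here; there; index)
open import Data.List.Relation.Unary.Any.Properties using (lookup-index)
open import Data.List.Relation.Unary.AllPairs using ([]; _∷_)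
open import Data.List.Relation.Unary.Unique.Propositional using (Unique)
import Data.List.Relation.Unary.Unique.Propositional.Properties as Unique
open import Data.Maybe using (just; nothing)
open import Data.Maybe.Properties using (just-injective)
open import Data.Nat as ℕ using (ℕ; zero; suc; NonZero; _%_; _≤_; _<_; z≤n; s≤s)
import Data.Nat.Properties as ℕ
open import Data.Nat.Coprimality using (Coprime; coprime-Bézout)
open import Data.Nat.Divisibility using (_∣_; _∣?_; divides; ∣1⇒≡1)
open import Data.Nat.DivMod using ([m+kn]%n≡m%n)
open import Data.Nat.GCD using (module Bézout)
open import Data.Nat.ListAction using (sum)
open import Data.Nat.Primality using (Prime; prime?; prime[2]; ¬prime[1]; prime⇒irreducible; euclidsLemma)
open import Data.Nat.Tactic.RingSolver using () renaming (solve-∀ to ℕ-solve-∀)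
open import Data.Product using (∃-syntax; _×_; _,_; proj₁; proj₂)
open import Data.Sum using (_⊎_; inj₁; inj₂)
open import Function using (_∘_)
open import Function.Bundles using (_⇔_; _↔_; _⤖_; Inverse; mk⇔; mk↔ₛ′)
open import Function.Construct.Composition using (_↔-∘_)
open import Function.Construct.Symmetry using (↔-sym)
open import Function.Properties.Inverse using (↔⇒⤖)
open import Function.Properties.Bijection using (⤖⇒↔)
open import Relation.Binary.Definitions using (tri<; tri≈; tri>)
open import Relation.Binary.PropositionalEquality
  using (_≡_; _≢_; refl; sym; trans; cong; cong₂; subst; module ≡-Reasoning)
open import Relation.Nullary using (¬_; Dec; yes; no; contradiction)
open import Relation.Nullary.Decidable using (decidable-stable; from-yes)

-- The argument runs entirely in the field: a point count enters only through its image under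
-- `fromℕ`, that is, modulo p. This loses nothing that matters, because ordinariness makes H
-- cancellable, and cancelling H from a scaling law such as H(dC) = d^e H(C) turns equality of
-- counts into d^e = 1. The degrees fit the isomorphism: d^((q-1)/6) = 1 is precisely the condition
-- for a sixth power, d^((q-1)/4) = 1 for a fourth power and v^((q-1)/2) = 1 for a square. That such
-- equations have roots is shown without a generator of the unit group. If d were not an n-th power,
-- a geometric sum in x^n/d would be a nonzero polynomial with more roots than its degree. The same
-- bound on roots governs the power sums, and the existence of roots yields Euler's criterion. If n
-- does not divide q - 1, the monomial of degree (q-1)/n is absent altogether; the sum then
-- vanishes, which ordinariness excludes.

n+n≡n*2 : ∀ n → n ℕ.+ n ≡ n ℕ.* 2
n+n≡n*2 = ℕ-solve-∀

n*4≡ : ∀ n → n ℕ.* 4 ≡ (n ℕ.+ n) ℕ.+ (n ℕ.+ n)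
n*4≡ = ℕ-solve-∀

n*6≡ : ∀ n → n ℕ.* 6 ≡ (n ℕ.+ n) ℕ.* 2 ℕ.+ (n ℕ.+ n)
n*6≡ = ℕ-solve-∀

-- Sums and products over all field elements

module FiniteSum (F : FiniteField) (M : CommutativeMonoid 0ℓ 0ℓ) where
  open FiniteField F using (enum; size) renaming (Carrier to 𝔽)
  open CommutativeMonoid M hiding (refl; sym) renaming (trans to ≈-trans)
  open Algebra.Properties.CommutativeMonoid.Sum M renaming (sum to ∑)
  open Inverse enum using (to; from; strictlyInverseˡ; strictlyInverseʳ)

  ⨁ : (𝔽 → Carrier) → Carrier
  ⨁ f = ∑ (λ i → f (to i))

  ⨁-cong : ∀ {f g} → (∀ x → f x ≈ g x) → ⨁ f ≈ ⨁ g
  ⨁-cong f≈g = sum-cong-≋ (λ i → f≈g (to i))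

  ⨁-distrib : ∀ f g → ⨁ (λ x → f x ∙ g x) ≈ ⨁ f ∙ ⨁ g
  ⨁-distrib f g = ∑-distrib-+ (f ∘ to) (g ∘ to)

  ⨁-reindex : ∀ f (σ : 𝔽 ↔ 𝔽) → ⨁ f ≈ ⨁ (f ∘ Inverse.to σ)
  ⨁-reindex f σ = ≈-trans
    (sum-permute (f ∘ to) (↔-sym enum ↔-∘ (σ ↔-∘ enum)))
    (sum-cong-≋ (λ i → reflexive (cong f (strictlyInverseˡ (Inverse.to σ (to i))))))

  sum-point : ∀ {n} (f : Fin n → Carrier) i → (∀ j → j ≢ i → f j ≈ ε) → ∑ f ≈ f i
  sum-point {suc n} f i f≈ε = ≈-trans (sum-remove {i = i} f)
    (≈-trans (∙-congˡ (≈-trans (sum-cong-≋ (λ j → f≈ε (punchIn i j) (punchInᵢ≢i i j)))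
                               (sum-replicate-zero n)))
             (identityʳ (f i)))

  ⨁-point : ∀ f a → (∀ x → x ≢ a → f x ≈ ε) → ⨁ f ≈ f a
  ⨁-point f a f≈ε = ≈-trans
    (sum-point (f ∘ to) (from a)
      (λ j j≢ → f≈ε (to j) (λ eq → j≢ (trans (sym (strictlyInverseʳ j)) (cong from eq)))))
    (reflexive (cong f (strictlyInverseˡ a)))

-- Arithmetic in a finite field

module FieldTheory (F : FiniteField) where
  commutativeRing : CommutativeRing 0ℓ 0ℓ
  commutativeRing = record { isCommutativeRing = FiniteField.isCommutativeRing F }

  open FiniteField F public
  open CommutativeRing commutativeRing public
    using ( semiring; commutativeSemiring; +-commutativeMonoid; *-commutativeMonoid
          ; +-assoc; +-identityˡ; +-identityʳ; -‿inverseˡ; -‿inverseʳ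
          ; *-assoc; *-comm; *-identityˡ; *-identityʳ; zeroˡ; zeroʳ; distribˡ; distribʳ )
  open Algebra.Properties.Ring (CommutativeRing.ring commutativeRing) public
    using (-1*x≈-x; -‿distribˡ-*; -‿distribʳ-*; -‿involutive; -0#≈0#; +-cancelˡ; +-cancelʳ)
    renaming (+-inverseˡ-unique to x+y≡0⇒x≡-y)
  open Algebra.Properties.Group (CommutativeRing.+-group commutativeRing) public
    using () renaming (x∙y⁻¹≈ε⇒x≈y to x-y≡0⇒x≡y)
  open import Algebra.Properties.Semiring.Exp semiring public
    using (_^_; ^-homo-*; ^-assocʳ)
  open Algebra.Properties.CommutativeSemiring.Exp commutativeSemiring public
    using (^-distrib-*)
  open import Algebra.Properties.Monoid.Mult (CommutativeRing.+-monoid commutativeRing) public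
    using () renaming (_×_ to _·_)
  open import Algebra.Solver.Ring.NaturalCoefficients.Default commutativeSemiring public
    using (solve; _:=_; _:+_; _:*_; _:^_)
  open Inverse enum public using (to; from; strictlyInverseˡ; strictlyInverseʳ)

  1≢0 : 1# ≢ 0#
  1≢0 eq = 0≢1 (sym eq)

  ⁻¹-inverseˡ : ∀ x → x ≢ 0# → x ⁻¹ * x ≡ 1#
  ⁻¹-inverseˡ x x≢0 = trans (*-comm _ _) (⁻¹-inverse x x≢0)

  *-cancelˡ : ∀ x {y z} → x ≢ 0# → x * y ≡ x * z → y ≡ z
  *-cancelˡ x {y} {z} x≢0 eq = trans (sym (undo y)) (trans (cong (x ⁻¹ *_) eq) (undo z))
    where
    undo : ∀ w → x ⁻¹ * (x * w) ≡ w
    undo w = trans (sym (*-assoc _ _ _))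
      (trans (cong (_* w) (⁻¹-inverseˡ x x≢0)) (*-identityˡ w))

  x*y≡0⇒y≡0 : ∀ {x y} → x ≢ 0# → x * y ≡ 0# → y ≡ 0#
  x*y≡0⇒y≡0 {x} x≢0 eq = *-cancelˡ x x≢0 (trans eq (sym (zeroʳ x)))

  *-≢0 : ∀ {x y} → x ≢ 0# → y ≢ 0# → x * y ≢ 0#
  *-≢0 x≢0 y≢0 eq = y≢0 (x*y≡0⇒y≡0 x≢0 eq)

  ⁻¹-≢0 : ∀ {x} → x ≢ 0# → x ⁻¹ ≢ 0#
  ⁻¹-≢0 {x} x≢0 eq = 1≢0 (trans (sym (⁻¹-inverse x x≢0)) (trans (cong (x *_) eq) (zeroʳ x)))

  ^-≢0 : ∀ {x} n → x ≢ 0# → x ^ n ≢ 0#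
  ^-≢0 zero    x≢0 = 1≢0
  ^-≢0 (suc n) x≢0 = *-≢0 x≢0 (^-≢0 n x≢0)

  x≡y⇒x-y≡0 : ∀ {x y} → x ≡ y → x + - y ≡ 0#
  x≡y⇒x-y≡0 {x} refl = -‿inverseʳ x

  1^n≡1 : ∀ n → 1# ^ n ≡ 1#
  1^n≡1 zero    = refl
  1^n≡1 (suc n) = trans (*-identityˡ _) (1^n≡1 n)

  *-↔ : ∀ u → u ≢ 0# → Carrier ↔ Carrier
  *-↔ u u≢0 = mk↔ₛ′ (u *_) (u ⁻¹ *_)
    (λ x → trans (sym (*-assoc _ _ _)) (trans (cong (_* x) (⁻¹-inverse u u≢0)) (*-identityˡ x)))
    (λ x → trans (sym (*-assoc _ _ _)) (trans (cong (_* x) (⁻¹-inverseˡ u u≢0)) (*-identityˡ x)))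

  1+-↔ : Carrier ↔ Carrier
  1+-↔ = mk↔ₛ′ (1# +_) (- 1# +_)
    (λ x → trans (sym (+-assoc _ _ _)) (trans (cong (_+ x) (-‿inverseʳ 1#)) (+-identityˡ x)))
    (λ x → trans (sym (+-assoc _ _ _)) (trans (cong (_+ x) (-‿inverseˡ 1#)) (+-identityˡ x)))

  fromℕ-+ : ∀ m n → fromℕ (m ℕ.+ n) ≡ fromℕ m + fromℕ n
  fromℕ-+ zero    n = sym (+-identityˡ _)
  fromℕ-+ (suc m) n = trans (cong (1# +_) (fromℕ-+ m n)) (sym (+-assoc _ _ _))

  fromℕ-* : ∀ m n → fromℕ (m ℕ.* n) ≡ fromℕ m * fromℕ n
  fromℕ-* zero    n = sym (zeroˡ _)
  fromℕ-* (suc m) n = begin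
    fromℕ (n ℕ.+ m ℕ.* n)            ≡⟨ fromℕ-+ n (m ℕ.* n) ⟩
    fromℕ n + fromℕ (m ℕ.* n)        ≡⟨ cong₂ _+_ (sym (*-identityˡ _)) (fromℕ-* m n) ⟩
    1# * fromℕ n + fromℕ m * fromℕ n ≡⟨ sym (distribʳ _ _ _) ⟩
    (1# + fromℕ m) * fromℕ n         ∎
    where open ≡-Reasoning

  fromℕ-^ : ∀ m n → fromℕ (m ℕ.^ n) ≡ fromℕ m ^ n
  fromℕ-^ m zero    = +-identityʳ 1#
  fromℕ-^ m (suc n) = trans (fromℕ-* m (m ℕ.^ n)) (cong (fromℕ m *_) (fromℕ-^ m n))

  ·1≡fromℕ : ∀ n → n · 1# ≡ fromℕ n
  ·1≡fromℕ zero    = refl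
  ·1≡fromℕ (suc n) = cong (1# +_) (·1≡fromℕ n)

  open FiniteSum F +-commutativeMonoid public using () renaming
    (⨁ to Σ𝔽; ⨁-cong to Σ-cong; ⨁-distrib to Σ-distrib-+; ⨁-reindex to Σ-reindex; ⨁-point to Σ-point)
  open FiniteSum F *-commutativeMonoid public using () renaming
    (⨁ to Π𝔽; ⨁-cong to Π-cong; ⨁-distrib to Π-distrib-*; ⨁-reindex to Π-reindex; ⨁-point to Π-point)
  module Sum = Algebra.Properties.Semiring.Sum semiring
  module Prod = Algebra.Properties.CommutativeMonoid.Sum *-commutativeMonoid

  *-distribˡ-Σ : ∀ c f → c * Σ𝔽 f ≡ Σ𝔽 (λ x → c * f x)
  *-distribˡ-Σ c f = Sum.*-distribˡ-sum c (f ∘ to)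

  Σ-zero : ∀ f → (∀ x → f x ≡ 0#) → Σ𝔽 f ≡ 0#
  Σ-zero f f≡0 = trans (Σ-cong f≡0) (Sum.sum-replicate-zero size)

  -- Translation by 1 permutes the field, so Σ (1 + x) = Σ x, and cancelling Σ x leaves Σ 1 = 0.
  fromℕ-size : fromℕ size ≡ 0#
  fromℕ-size = trans (sym (trans (Sum.sum-replicate size) (·1≡fromℕ size)))
    (+-cancelʳ (Σ𝔽 (λ x → x)) _ _ (begin
      Σ𝔽 (λ _ → 1#) + Σ𝔽 (λ x → x) ≡⟨ sym (Σ-distrib-+ (λ _ → 1#) (λ x → x)) ⟩
      Σ𝔽 (1# +_)                   ≡⟨ sym (Σ-reindex (λ x → x) 1+-↔) ⟩
      Σ𝔽 (λ x → x)                 ≡⟨ sym (+-identityˡ _) ⟩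
      0# + Σ𝔽 (λ x → x)            ∎))
    where open ≡-Reasoning

  Σ-one : Σ𝔽 (λ _ → 1#) ≡ 0#
  Σ-one = trans (Sum.sum-replicate size) (trans (·1≡fromℕ size) fromℕ-size)

  -- Fermat's little theorem

  if0 : Carrier → Carrier → Carrier → Carrier
  if0 x a b with x ≟ 0#
  ... | yes _ = a
  ... | no  _ = b

  if0-yes : ∀ {x} a b → x ≡ 0# → if0 x a b ≡ a
  if0-yes {x} a b x≡0 with x ≟ 0#
  ... | yes _   = refl
  ... | no  x≢0 = contradiction x≡0 x≢0

  if0-no : ∀ {x} a b → x ≢ 0# → if0 x a b ≡ b
  if0-no {x} a b x≢0 with x ≟ 0#
  ... | yes x≡0 = contradiction x≡0 x≢0
  ... | no  _   = refl

  prod-≢0 : ∀ {n} (f : Fin n → Carrier) → (∀ i → f i ≢ 0#) → Prod.sum f ≢ 0#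
  prod-≢0 {zero}  f f≢0 = 1≢0
  prod-≢0 {suc n} f f≢0 = *-≢0 (f≢0 zero) (prod-≢0 (f ∘ suc) (f≢0 ∘ suc))

  -- Multiplication by `y` permutes the units and so preserves their product. The products here run
  -- over the whole field, with the factor at 0 replaced by 1; the factor `y` left over at x = 0
  -- accounts for the exponent q in place of q - 1.
  fermat : ∀ {y} → y ≢ 0# → y ^ size ≡ y
  fermat {y} y≢0 = begin
    y ^ size                                       ≡⟨ sym (Prod.sum-replicate size) ⟩
    Π𝔽 (λ _ → y)                                   ≡⟨ Π-cong (λ x → sym (split x)) ⟩
    Π𝔽 (λ x → if0 x 1# y * if0 x y 1#)             ≡⟨ Π-distrib-* (λ x → if0 x 1# y) (λ x → if0 x y 1#) ⟩
    Π𝔽 (λ x → if0 x 1# y) * Π𝔽 (λ x → if0 x y 1#)  ≡⟨ cong₂ _*_ Π-units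
                                                       (trans (Π-point _ 0# (λ x → if0-no y 1#))
                                                              (if0-yes y 1# refl)) ⟩
    1# * y                                         ≡⟨ *-identityˡ y ⟩
    y                                              ∎
    where
    open ≡-Reasoning
    split : ∀ x → if0 x 1# y * if0 x y 1# ≡ y
    split x with x ≟ 0#
    ... | yes _ = *-identityˡ y
    ... | no  _ = *-identityʳ y
    unit : Carrier → Carrier
    unit x = if0 x 1# x
    unit-≢0 : ∀ x → unit x ≢ 0#
    unit-≢0 x with x ≟ 0#
    ... | yes _   = 1≢0
    ... | no  x≢0 = x≢0
    unit-* : ∀ x → unit (y * x) ≡ if0 x 1# y * unit x
    unit-* x with x ≟ 0#
    ... | yes refl = trans (if0-yes 1# _ (zeroʳ y)) (sym (*-identityˡ 1#))
    ... | no  x≢0  = if0-no 1# _ (*-≢0 y≢0 x≢0)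
    Π-units : Π𝔽 (λ x → if0 x 1# y) ≡ 1#
    Π-units = *-cancelˡ (Π𝔽 unit) (prod-≢0 _ (unit-≢0 ∘ to)) (begin
      Π𝔽 unit * Π𝔽 (λ x → if0 x 1# y)   ≡⟨ *-comm _ _ ⟩
      Π𝔽 (λ x → if0 x 1# y) * Π𝔽 unit   ≡⟨ sym (Π-distrib-* (λ x → if0 x 1# y) unit) ⟩
      Π𝔽 (λ x → if0 x 1# y * unit x)    ≡⟨ Π-cong (λ x → sym (unit-* x)) ⟩
      Π𝔽 (λ x → unit (y * x))           ≡⟨ sym (Π-reindex unit (*-↔ y y≢0)) ⟩
      Π𝔽 unit                           ≡⟨ sym (*-identityʳ _) ⟩
      Π𝔽 unit * 1#                      ∎)

  fermat-unit : ∀ {N y} → size ≡ suc N → y ≢ 0# → y ^ N ≡ 1#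
  fermat-unit {N} {y} size≡ y≢0 = *-cancelˡ y y≢0
    (trans (subst (λ s → y ^ s ≡ y) size≡ (fermat y≢0)) (sym (*-identityʳ y)))

  -- Polynomials as coefficient lists and the number of their roots

  eval : List Carrier → Carrier → Carrier
  eval []       x = 0#
  eval (c ∷ cs) x = c + x * eval cs x

  -- Horner's scheme, listing the values at `r` of the successive suffixes. The quotient of `c ∷ cs`
  -- by X - r is `quotient r cs`, since the constant coefficient affects only the remainder.
  quotient : Carrier → List Carrier → List Carrier
  quotient r []       = []
  quotient r (c ∷ cs) = eval (c ∷ cs) r ∷ quotient r cs

  length-quotient : ∀ r cs → length (quotient r cs) ≡ length cs
  length-quotient r []       = refl
  length-quotient r (c ∷ cs) = cong suc (length-quotient r cs)

  -- The division identity p(x) − p(r) = (x − r) q(x) with the subtractions moved across.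
  eval-quotient : ∀ r c cs x →
    eval (c ∷ cs) x + r * eval (quotient r cs) x ≡ eval (c ∷ cs) r + x * eval (quotient r cs) x
  eval-quotient r c []       x = reorder c x r 0#
    where
    reorder : ∀ c x r z → (c + x * z) + r * z ≡ (c + r * z) + x * z
    reorder = solve 4 (λ c x r z → (c :+ x :* z) :+ r :* z := (c :+ r :* z) :+ x :* z) refl
  eval-quotient r c (d ∷ ds) x = begin
    (c + x * p) + r * (e + x * q)  ≡⟨ left c x p r e q ⟩
    c + r * e + x * (p + r * q)    ≡⟨ cong (λ w → c + r * e + x * w) (eval-quotient r d ds x) ⟩
    c + r * e + x * (e + x * q)    ∎
    where
    open ≡-Reasoning
    p = eval (d ∷ ds) x
    e = eval (d ∷ ds) r
    q = eval (quotient r ds) x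
    left : ∀ c x p r e q → (c + x * p) + r * (e + x * q) ≡ c + r * e + x * (p + r * q)
    left = solve 6 (λ c x p r e q → (c :+ x :* p) :+ r :* (e :+ x :* q)
         := c :+ r :* e :+ x :* (p :+ r :* q)) refl

  -- Horner's scheme is triangular: each suffix value is a coefficient plus `r` times the next
  -- suffix value, so if all these values vanish, so do the coefficients.
  quotient-zero : ∀ r c cs → eval (c ∷ cs) r ≡ 0# → All (_≡ 0#) (quotient r cs) → All (_≡ 0#) (c ∷ cs)
  quotient-zero r c []       root []         =
    trans (sym (trans (cong (c +_) (zeroʳ r)) (+-identityʳ c))) root ∷ []
  quotient-zero r c (d ∷ ds) root (e≡0 ∷ qs) =
    trans (sym (trans (cong (λ w → c + r * w) e≡0) (trans (cong (c +_) (zeroʳ r)) (+-identityʳ c)))) root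
    ∷ quotient-zero r d ds e≡0 qs

  -- Dividing by X - r removes one coefficient and one root; the other roots survive because r - x
  -- is cancellable. Top coefficients may be zero, so the length is only an upper bound for the
  -- degree plus one.
  roots-bound : ∀ rs cs → Unique rs → length cs ≤ length rs →
    All (λ r → eval cs r ≡ 0#) rs → All (_≡ 0#) cs
  roots-bound rs       []       _                _           _              = []
  roots-bound (r ∷ rs) (c ∷ cs) (r∉rs ∷ unique) (s≤s cs≤rs) (root ∷ roots) =
    quotient-zero r c cs root
      (roots-bound rs (quotient r cs) unique
        (subst (_≤ length rs) (sym (length-quotient r cs)) cs≤rs)
        (All.zipWith (λ (r≢x , px≡0) → root-of-quotient r≢x px≡0) (r∉rs , roots)))
    where
    open ≡-Reasoning
    root-of-quotient : ∀ {x} → r ≢ x → eval (c ∷ cs) x ≡ 0# → eval (quotient r cs) x ≡ 0#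
    root-of-quotient {x} r≢x px≡0 = x*y≡0⇒y≡0 (λ r-x≡0 → r≢x (x-y≡0⇒x≡y r x r-x≡0)) (begin
      (r + - x) * q      ≡⟨ distribʳ _ _ _ ⟩
      r * q + - x * q    ≡⟨ cong₂ _+_ rq≡xq (sym (-‿distribˡ-* x q)) ⟩
      x * q + - (x * q)  ≡⟨ -‿inverseʳ _ ⟩
      0#                 ∎)
      where
      q = eval (quotient r cs) x
      rq≡xq : r * q ≡ x * q
      rq≡xq = +-cancelˡ 0# _ _ (trans (cong (_+ r * q) (sym px≡0))
        (trans (eval-quotient r c cs x) (cong (_+ x * q) root)))

  elements : List Carrier
  elements = map to (allFin size)

  elements-unique : Unique elements
  elements-unique = Unique.map⁺
    (λ {i} {j} eq → trans (sym (strictlyInverseʳ i)) (trans (cong from eq) (strictlyInverseʳ j)))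
    (Unique.allFin⁺ size)

  length-elements : length elements ≡ size
  length-elements = trans (length-map to (allFin size)) (length-tabulate (λ i → i))

  -- Multiplying by X, which prepends `0#`, makes 0 a root as well, so the bound applies to the list
  -- of all elements. The strict inequality leaves room for the extra coefficient.
  vanishing-on-units : ∀ cs → length cs < size → (∀ x → x ≢ 0# → eval cs x ≡ 0#) → All (_≡ 0#) cs
  vanishing-on-units cs cs<size vanish =
    All.tail (roots-bound elements (0# ∷ cs) elements-unique
      (subst (suc (length cs) ≤_) (sym length-elements) cs<size)
      (All.tabulate (λ {x} _ → vanish′ x)))
    where
    vanish′ : ∀ x → 0# + x * eval cs x ≡ 0#
    vanish′ x with x ≟ 0#
    ... | yes refl = trans (+-identityˡ _) (zeroˡ _)
    ... | no x≢0   = trans (+-identityˡ _) (trans (cong (x *_) (vanish x x≢0)) (zeroʳ x))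

  eval-shift : ∀ n cs x → eval (replicate n 0# ++ cs) x ≡ x ^ n * eval cs x
  eval-shift zero    cs x = sym (*-identityˡ _)
  eval-shift (suc n) cs x = trans (+-identityˡ _)
    (trans (cong (x *_) (eval-shift n cs x)) (sym (*-assoc _ _ _)))

  eval-scale : ∀ c cs x → eval (map (c *_) cs) x ≡ c * eval cs x
  eval-scale c []       x = sym (zeroʳ c)
  eval-scale c (d ∷ cs) x = trans (cong (λ w → c * d + x * w) (eval-scale c cs x)) (factor c d x (eval cs x))
    where
    factor : ∀ c d x e → c * d + x * (c * e) ≡ c * (d + x * e)
    factor = solve 4 (λ c d x e → c :* d :+ x :* (c :* e) := c :* (d :+ x :* e)) refl

  -- Otherwise X^(k+1) - 1, of degree below N, would vanish on all N units, and its constant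
  -- coefficient -1 would be 0.
  units-exponent : ∀ {N k} → size ≡ suc N → suc k < N → ¬ (∀ y → y ≢ 0# → y ^ suc k ≡ 1#)
  units-exponent {N} {k} size≡ k<N trivial =
    1≢0 (trans (sym (-‿involutive 1#)) (trans (cong -_ (All.head coeffs≡0)) -0#≈0#))
    where
    open ≡-Reasoning
    coeffs = - 1# ∷ (replicate k 0# ++ 1# ∷ [])
    length-coeffs : length coeffs ≡ suc (suc k)
    length-coeffs = cong suc (trans (length-++ (replicate k 0#))
      (trans (cong (ℕ._+ 1) (length-replicate k)) (ℕ.+-comm k 1)))
    vanish : ∀ x → x ≢ 0# → eval coeffs x ≡ 0#
    vanish x x≢0 = begin
      - 1# + x * eval (replicate k 0# ++ 1# ∷ []) x ≡⟨ cong (λ w → - 1# + x * w) (eval-shift k _ x) ⟩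
      - 1# + x * (x ^ k * (1# + x * 0#))            ≡⟨ cong (λ w → - 1# + x * (x ^ k * w))
                                                         (trans (cong (1# +_) (zeroʳ x)) (+-identityʳ 1#)) ⟩
      - 1# + x * (x ^ k * 1#)                       ≡⟨ cong (λ w → - 1# + x * w) (*-identityʳ _) ⟩
      - 1# + x ^ suc k                              ≡⟨ cong (- 1# +_) (trivial x x≢0) ⟩
      - 1# + 1#                                     ≡⟨ -‿inverseˡ 1# ⟩
      0#                                            ∎
    coeffs≡0 : All (_≡ 0#) coeffs
    coeffs≡0 = vanishing-on-units coeffs
      (subst (_< size) (sym length-coeffs) (subst (suc (suc k) <_) (sym size≡) (s≤s k<N))) vanish

  -- Power sums

  powerSum : ℕ → Carrier
  powerSum k = Σ𝔽 (_^ k)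

  -- The substitution of y x for x leaves the sum unchanged and multiplies it by y^k.
  powerSum≢0⇒trivial : ∀ k → powerSum k ≢ 0# → ∀ y → y ≢ 0# → y ^ k ≡ 1#
  powerSum≢0⇒trivial k P≢0 y y≢0 = *-cancelˡ (powerSum k) P≢0 (begin
    powerSum k * y ^ k           ≡⟨ *-comm _ _ ⟩
    y ^ k * powerSum k           ≡⟨ *-distribˡ-Σ (y ^ k) (_^ k) ⟩
    Σ𝔽 (λ x → y ^ k * x ^ k)     ≡⟨ Σ-cong (λ x → sym (^-distrib-* y x k)) ⟩
    Σ𝔽 (λ x → (y * x) ^ k)       ≡⟨ sym (Σ-reindex (_^ k) (*-↔ y y≢0)) ⟩
    powerSum k                   ≡⟨ sym (*-identityʳ _) ⟩
    powerSum k * 1#              ∎)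
    where open ≡-Reasoning

  -- A nonzero power sum makes `k` an exponent of the unit group. Exponents strictly between 0 and N
  -- are impossible, and those strictly between N and 2N reduce to them by y^N = 1. For k = 0 the
  -- convention 0^0 = 1 makes the sum q, which is 0 in the field.
  powerSum≢0⇒≡N : ∀ {N} k → size ≡ suc N → k < N ℕ.+ N → powerSum k ≢ 0# → k ≡ N
  powerSum≢0⇒≡N {N} k size≡ k<2N P≢0 with ℕ.<-cmp k N
  ... | tri≈ _ k≡N _ = k≡N
  powerSum≢0⇒≡N zero    size≡ k<2N P≢0 | tri< _ _ _   = contradiction Σ-one P≢0
  powerSum≢0⇒≡N (suc k) size≡ k<2N P≢0 | tri< k<N _ _ =
    contradiction (powerSum≢0⇒trivial (suc k) P≢0) (units-exponent size≡ k<N)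
  powerSum≢0⇒≡N {N} k size≡ k<2N P≢0 | tri> _ _ N<k with ℕ.m≤n⇒∃[o]m+o≡n N<k
  ... | o , refl = contradiction trivial
    (units-exponent size≡ (ℕ.+-cancelˡ-< N (suc o) N (subst (_< N ℕ.+ N) (sym (ℕ.+-suc N o)) k<2N)))
    where
    open ≡-Reasoning
    trivial : ∀ y → y ≢ 0# → y ^ suc o ≡ 1#
    trivial y y≢0 = begin
      y ^ suc o              ≡⟨ sym (*-identityˡ _) ⟩
      1# * y ^ suc o         ≡⟨ cong (_* y ^ suc o) (sym (fermat-unit size≡ y≢0)) ⟩
      y ^ N * y ^ suc o      ≡⟨ sym (^-homo-* y N (suc o)) ⟩
      y ^ (N ℕ.+ suc o)      ≡⟨ cong (y ^_) (ℕ.+-suc N o) ⟩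
      y ^ (suc N ℕ.+ o)      ≡⟨ powerSum≢0⇒trivial (suc N ℕ.+ o) P≢0 y y≢0 ⟩
      1#                     ∎

  -- Existence of roots by geometric sums

  -- Coefficients of Σ_{i<j} (c X^{k+1})^i, padded with zeros to length j (k+1).
  geometric : Carrier → ℕ → ℕ → List Carrier
  geometric c k zero    = []
  geometric c k (suc j) = 1# ∷ (replicate k 0# ++ map (c *_) (geometric c k j))

  length-geometric : ∀ c k j → length (geometric c k j) ≡ j ℕ.* suc k
  length-geometric c k zero    = refl
  length-geometric c k (suc j) = cong suc (trans (length-++ (replicate k 0#))
    (cong₂ ℕ._+_ (length-replicate k) (trans (length-map (c *_) (geometric c k j)) (length-geometric c k j))))

  eval-geometric-suc : ∀ c k j x →
    eval (geometric c k (suc j)) x ≡ 1# + (c * x ^ suc k) * eval (geometric c k j) x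
  eval-geometric-suc c k j x = begin
    1# + x * eval (replicate k 0# ++ map (c *_) g) x  ≡⟨ cong (λ w → 1# + x * w) (eval-shift k _ x) ⟩
    1# + x * (x ^ k * eval (map (c *_) g) x)
      ≡⟨ cong (λ w → 1# + x * (x ^ k * w)) (eval-scale c g x) ⟩
    1# + x * (x ^ k * (c * eval g x))                 ≡⟨ cong (1# +_) (reorder x (x ^ k) c (eval g x)) ⟩
    1# + (c * (x * x ^ k)) * eval g x                 ∎
    where
    open ≡-Reasoning
    g = geometric c k j
    reorder : ∀ x y c e → x * (y * (c * e)) ≡ (c * (x * y)) * e
    reorder = solve 4 (λ x y c e → x :* (y :* (c :* e)) := (c :* (x :* y)) :* e) refl

  -- The identity (r - 1)(1 + r + ... + r^(j-1)) = r^j - 1 with the subtractions moved across, so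
  -- that it is a semiring identity.
  geometric-telescope : ∀ c k j x → let r = c * x ^ suc k; e = eval (geometric c k j) x in
    r * e + 1# ≡ e + r ^ j
  geometric-telescope c k zero    x = cong (_+ 1#) (zeroʳ _)
  geometric-telescope c k (suc j) x = begin
    r * eval (geometric c k (suc j)) x + 1#  ≡⟨ cong (λ w → r * w + 1#) (eval-geometric-suc c k j x) ⟩
    r * (1# + r * e) + 1#                    ≡⟨ left 1# r e ⟩
    1# + r * (r * e + 1#)                    ≡⟨ cong (λ w → 1# + r * w) (geometric-telescope c k j x) ⟩
    1# + r * (e + r ^ j)                     ≡⟨ right 1# r e (r ^ j) ⟩
    (1# + r * e) + r * r ^ j                 ≡⟨ cong (_+ r ^ suc j) (sym (eval-geometric-suc c k j x)) ⟩
    eval (geometric c k (suc j)) x + r ^ suc j ∎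
    where
    open ≡-Reasoning
    r = c * x ^ suc k
    e = eval (geometric c k j) x
    left : ∀ o r e → r * (o + r * e) + o ≡ o + r * (r * e + o)
    left = solve 3 (λ o r e → r :* (o :+ r :* e) :+ o := o :+ r :* (r :* e :+ o)) refl
    right : ∀ o r e p → o + r * (e + p) ≡ (o + r * e) + r * p
    right = solve 4 (λ o r e p → o :+ r :* (e :+ p) := (o :+ r :* e) :+ r :* p) refl

  geometric-root : ∀ c k j x → let r = c * x ^ suc k in
    r ≢ 1# → r ^ j ≡ 1# → eval (geometric c k j) x ≡ 0#
  geometric-root c k j x r≢1 r^j≡1 = x*y≡0⇒y≡0 (λ r-1≡0 → r≢1 (x-y≡0⇒x≡y _ _ r-1≡0)) (begin
    (r + - 1#) * e       ≡⟨ distribʳ _ _ _ ⟩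
    r * e + - 1# * e     ≡⟨ cong₂ _+_ re≡e (-1*x≈-x e) ⟩
    e + - e              ≡⟨ -‿inverseʳ e ⟩
    0#                   ∎)
    where
    open ≡-Reasoning
    r = c * x ^ suc k
    e = eval (geometric c k j) x
    re≡e : r * e ≡ e
    re≡e = +-cancelʳ 1# _ _ (trans (geometric-telescope c k j x) (cong (e +_) r^j≡1))

  ⁻¹-^ : ∀ {x} n → x ≢ 0# → x ^ n ≡ 1# → (x ⁻¹) ^ n ≡ 1#
  ⁻¹-^ {x} n x≢0 x^n≡1 = begin
    (x ⁻¹) ^ n            ≡⟨ sym (*-identityˡ _) ⟩
    1# * (x ⁻¹) ^ n       ≡⟨ cong (_* (x ⁻¹) ^ n) (sym x^n≡1) ⟩
    x ^ n * (x ⁻¹) ^ n    ≡⟨ sym (^-distrib-* x (x ⁻¹) n) ⟩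
    (x * x ⁻¹) ^ n        ≡⟨ cong (_^ n) (⁻¹-inverse x x≢0) ⟩
    1# ^ n                ≡⟨ 1^n≡1 n ⟩
    1#                    ∎
    where open ≡-Reasoning

  -- If d = u^n has no solution then x^n/d, an e-th root of unity for x ≠ 0, is never 1,
  -- so the geometric sum of degree n (e − 1) < N vanishes on all N units.
  nth-root : ∀ {N} n e d → size ≡ suc N → N ≡ suc e ℕ.* suc n → d ≢ 0# → d ^ suc e ≡ 1# →
    ∃[ u ] u ^ suc n ≡ d
  nth-root {N} n e d size≡ N≡ d≢0 d^e≡1 with any? (λ i → (to i) ^ suc n ≟ d)
  ... | yes (i , eq) = to i , eq
  -- All N coefficients would have to vanish, yet the constant one is 1.
  ... | no ∄root = contradiction (All.head coeffs≡0) 1≢0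
    where
    open ≡-Reasoning
    c = d ⁻¹
    vanish : ∀ x → x ≢ 0# → eval (geometric c n (suc e)) x ≡ 0#
    vanish x x≢0 = geometric-root c n (suc e) x
      (λ r≡1 → ∄root (from x , trans (cong (_^ suc n) (strictlyInverseˡ x)) (x^n≡d r≡1)))
      (begin
        (c * x ^ suc n) ^ suc e          ≡⟨ ^-distrib-* c _ (suc e) ⟩
        c ^ suc e * (x ^ suc n) ^ suc e  ≡⟨ cong₂ _*_ (⁻¹-^ (suc e) d≢0 d^e≡1) (^-assocʳ x (suc n) (suc e)) ⟩
        1# * x ^ (suc n ℕ.* suc e)       ≡⟨ *-identityˡ _ ⟩
        x ^ (suc n ℕ.* suc e)            ≡⟨ cong (x ^_) (trans (ℕ.*-comm (suc n) (suc e)) (sym N≡)) ⟩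
        x ^ N                            ≡⟨ fermat-unit size≡ x≢0 ⟩
        1#                               ∎)
      where
      x^n≡d : c * x ^ suc n ≡ 1# → x ^ suc n ≡ d
      x^n≡d r≡1 = *-cancelˡ c (⁻¹-≢0 d≢0) (trans r≡1 (sym (⁻¹-inverseˡ d d≢0)))
    coeffs≡0 : All (_≡ 0#) (geometric c n (suc e))
    coeffs≡0 = vanishing-on-units (geometric c n (suc e))
      (subst (_< size) (sym (trans (length-geometric c n (suc e)) (sym N≡)))
        (ℕ.≤-reflexive (sym size≡)))
      vanish

  -- Homogeneity of the Hasse sum when A = 0 or B = 0

  -- The common shape of the two degenerate Hasse sums: a = 0, b = 3 for x³ + C, and a = n, b = 2
  -- for x³ + C x = x (x² + C). A free `a` is needed for the induction on `n`, which shifts it by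
  -- `b`.
  twistedSum : ℕ → Carrier → ℕ → ℕ → Carrier
  twistedSum b C n a = Σ𝔽 (λ x → x ^ a * (x ^ b + C) ^ n)

  twistedSum-zero : ∀ b C a → twistedSum b C 0 a ≡ powerSum a
  twistedSum-zero b C a = Σ-cong {g = _^ a} (λ x → *-identityʳ _)

  twistedSum-suc : ∀ b C n a →
    twistedSum b C (suc n) a ≡ twistedSum b C n (a ℕ.+ b) + C * twistedSum b C n a
  twistedSum-suc b C n a = begin
    Σ𝔽 (λ x → x ^ a * ((x ^ b + C) * (x ^ b + C) ^ n))
      ≡⟨ Σ-cong (λ x → trans (expand (x ^ a) (x ^ b) C ((x ^ b + C) ^ n))
                             (cong (λ w → w * (x ^ b + C) ^ n + C * (x ^ a * (x ^ b + C) ^ n))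
                                   (sym (^-homo-* x a b)))) ⟩
    Σ𝔽 (λ x → x ^ (a ℕ.+ b) * (x ^ b + C) ^ n + C * (x ^ a * (x ^ b + C) ^ n))
      ≡⟨ Σ-distrib-+ (λ x → x ^ (a ℕ.+ b) * (x ^ b + C) ^ n) (λ x → C * (x ^ a * (x ^ b + C) ^ n)) ⟩
    twistedSum b C n (a ℕ.+ b) + Σ𝔽 (λ x → C * (x ^ a * (x ^ b + C) ^ n))
      ≡⟨ cong (twistedSum b C n (a ℕ.+ b) +_) (sym (*-distribˡ-Σ C (λ x → x ^ a * (x ^ b + C) ^ n))) ⟩
    twistedSum b C n (a ℕ.+ b) + C * twistedSum b C n a ∎
    where
    open ≡-Reasoning
    expand : ∀ p q c z → p * ((q + c) * z) ≡ (p * q) * z + c * (p * z)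
    expand = solve 4 (λ p q c z → p :* ((q :+ c) :* z) := (p :* q) :* z :+ c :* (p :* z)) refl

  -- In the expansion of (x^b + C)^n only the term x^{bk} C^{n−k} with n − k = e survives summation.
  twistedSum-homogeneous : ∀ b d C n a e →
    (∀ k → k ≤ n → powerSum (a ℕ.+ k ℕ.* b) ≢ 0# → k ℕ.+ e ≡ n) →
    twistedSum b (d * C) n a ≡ d ^ e * twistedSum b C n a
  twistedSum-homogeneous b d C zero a e only = begin
    twistedSum b (d * C) 0 a   ≡⟨ twistedSum-zero b (d * C) a ⟩
    powerSum a                 ≡⟨ d^e-trivial ⟩
    d ^ e * powerSum a         ≡⟨ cong (d ^ e *_) (sym (twistedSum-zero b C a)) ⟩
    d ^ e * twistedSum b C 0 a ∎
    where
    open ≡-Reasoning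
    d^e-trivial : powerSum a ≡ d ^ e * powerSum a
    d^e-trivial with powerSum a ≟ 0#
    ... | yes P≡0 = trans P≡0 (sym (trans (cong (d ^ e *_) P≡0) (zeroʳ _)))
    -- With n = 0 a surviving power sum forces e = 0, so d^e = 1.
    ... | no  P≢0 with only 0 z≤n (λ P≡0 → P≢0 (trans (cong powerSum (sym (ℕ.+-identityʳ a))) P≡0))
    ...   | refl = sym (*-identityˡ _)
  twistedSum-homogeneous b d C (suc n) a e only = begin
    T (d * C) (suc n) a
      ≡⟨ twistedSum-suc b (d * C) n a ⟩
    T (d * C) n (a ℕ.+ b) + (d * C) * T (d * C) n a
      ≡⟨ cong₂ _+_ (twistedSum-homogeneous b d C n (a ℕ.+ b) e shifted)
                   (trans (reorder d C _) (cong (C *_) (last e only))) ⟩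
    d ^ e * T C n (a ℕ.+ b) + C * (d ^ e * T C n a)
      ≡⟨ factor (d ^ e) C _ _ ⟩
    d ^ e * (T C n (a ℕ.+ b) + C * T C n a)
      ≡⟨ cong (d ^ e *_) (sym (twistedSum-suc b C n a)) ⟩
    d ^ e * T C (suc n) a ∎
    where
    open ≡-Reasoning
    T = twistedSum b
    reorder : ∀ d c t → (d * c) * t ≡ c * (d * t)
    reorder = solve 3 (λ d c t → (d :* c) :* t := c :* (d :* t)) refl
    factor : ∀ p c s t → p * s + c * (p * t) ≡ p * (s + c * t)
    factor = solve 4 (λ p c s t → p :* s :+ c :* (p :* t) := p :* (s :+ c :* t)) refl
    shifted : ∀ k → k ≤ n → powerSum (a ℕ.+ b ℕ.+ k ℕ.* b) ≢ 0# → k ℕ.+ e ≡ n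
    shifted k k≤n P≢0 = ℕ.suc-injective (only (suc k) (s≤s k≤n)
      (λ P≡0 → P≢0 (trans (cong powerSum (ℕ.+-assoc a b (k ℕ.* b))) P≡0)))
    -- The factor `d` of d C uses up one degree, so the induction hypothesis is wanted at e - 1; for
    -- e = 0 a separate argument is necessary.
    last : ∀ e → (∀ k → k ≤ suc n → powerSum (a ℕ.+ k ℕ.* b) ≢ 0# → k ℕ.+ e ≡ suc n) →
      d * T (d * C) n a ≡ d ^ e * T C n a
    last (suc e) only = trans
      (cong (d *_) (twistedSum-homogeneous b d C n a e
        (λ k k≤n P≢0 → ℕ.suc-injective (trans (sym (ℕ.+-suc k e)) (only k (ℕ.m≤n⇒m≤1+n k≤n) P≢0)))))
      (sym (*-assoc _ _ _))
    -- No power sum survives, so the sum is homogeneous of degrees 0 and 1 at once.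
    last zero only = begin
      d * T (d * C) n a     ≡⟨ cong (d *_) (twistedSum-homogeneous b d C n a 0 (none 0)) ⟩
      d * (1# * T C n a)    ≡⟨ sym (*-assoc _ _ _) ⟩
      (d * 1#) * T C n a    ≡⟨ sym (twistedSum-homogeneous b d C n a 1 (none 1)) ⟩
      T (d * C) n a         ≡⟨ twistedSum-homogeneous b d C n a 0 (none 0) ⟩
      1# * T C n a          ∎
      where
      none : ∀ e k → k ≤ n → powerSum (a ℕ.+ k ℕ.* b) ≢ 0# → k ℕ.+ e ≡ n
      none e k k≤n P≢0 = contradiction (trans (sym (ℕ.+-identityʳ k)) (only k (ℕ.m≤n⇒m≤1+n k≤n) P≢0))
        (ℕ.<⇒≢ (s≤s k≤n))

  -- Homogeneity of degree `e` gives d^e T = T, and T can be cancelled. All exponents that occur lie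
  -- below 2N, so N is the only one whose power sum may survive.
  twist-exponent : ∀ {N} b a m d C e → size ≡ suc N → a ℕ.+ m ℕ.* b < N ℕ.+ N →
    twistedSum b C m a ≢ 0# → twistedSum b (d * C) m a ≡ twistedSum b C m a →
    (∀ k → k ≤ m → a ℕ.+ k ℕ.* b ≡ N → k ℕ.+ e ≡ m) → d ^ e ≡ 1#
  twist-exponent {N} b a m d C e size≡ bound T≢0 T≡ only = *-cancelˡ (twistedSum b C m a) T≢0 (begin
    twistedSum b C m a * d ^ e  ≡⟨ *-comm _ _ ⟩
    d ^ e * twistedSum b C m a  ≡⟨ sym (twistedSum-homogeneous b d C m a e surviving) ⟩
    twistedSum b (d * C) m a    ≡⟨ T≡ ⟩
    twistedSum b C m a          ≡⟨ sym (*-identityʳ _) ⟩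
    twistedSum b C m a * 1#     ∎)
    where
    open ≡-Reasoning
    surviving : ∀ k → k ≤ m → powerSum (a ℕ.+ k ℕ.* b) ≢ 0# → k ℕ.+ e ≡ m
    surviving k k≤m P≢0 = only k k≤m (powerSum≢0⇒≡N _ size≡
      (ℕ.≤-<-trans (ℕ.+-monoʳ-≤ a (ℕ.*-monoˡ-≤ b k≤m)) bound) P≢0)

  -- By `degree`, the power of C beside a surviving power sum has exponent N/(n+1). Then d^(N/(n+1))
  -- = 1, which is the hypothesis under which `nth-root` extracts an (n+1)-th root.
  twist-is-power : ∀ {N} n b a m d C → size ≡ suc N → N ≢ 0 → a ℕ.+ m ℕ.* b < N ℕ.+ N →
    (∀ k → k ≤ m → a ℕ.+ k ℕ.* b ≡ N → (m ℕ.∸ k) ℕ.* suc n ≡ N) →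
    d ≢ 0# → twistedSum b C m a ≢ 0# → twistedSum b (d * C) m a ≡ twistedSum b C m a →
    ∃[ u ] u ^ suc n ≡ d
  twist-is-power {N} n b a m d C size≡ N≢0 bound degree d≢0 T≢0 T≡ with suc n ∣? N
  ... | yes (divides zero    N≡) = contradiction N≡ N≢0
  ... | yes (divides (suc e) N≡) = nth-root n e d size≡ N≡ d≢0
    (twist-exponent b a m d C (suc e) size≡ bound T≢0 T≡ λ k k≤m eq →
      trans (cong (k ℕ.+_) (sym (ℕ.*-cancelʳ-≡ _ _ (suc n) (trans (degree k k≤m eq) N≡))))
            (ℕ.m+[n∸m]≡n k≤m))
  -- No power sum survives, so d^e = 1 for every e, in particular d = 1.
  ... | no n∤N = 1# , trans (1^n≡1 (suc n)) (sym (trans (sym (*-identityʳ d))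
    (twist-exponent b a m d C 1 size≡ bound T≢0 T≡ λ k k≤m eq →
      contradiction (divides (m ℕ.∸ k) (sym (degree k k≤m eq))) n∤N)))

  -- Square roots and Euler's criterion

  δ : Carrier → Carrier → Carrier
  δ a b with a ≟ b
  ... | yes _ = 1#
  ... | no  _ = 0#

  δ-yes : ∀ {a b} → a ≡ b → δ a b ≡ 1#
  δ-yes {a} {b} a≡b with a ≟ b
  ... | yes _   = refl
  ... | no  a≢b = contradiction a≡b a≢b

  δ-no : ∀ {a b} → a ≢ b → δ a b ≡ 0#
  δ-no {a} {b} a≢b with a ≟ b
  ... | yes a≡b = contradiction a≡b a≢b
  ... | no  _   = refl

  Σ-δ : ∀ w → Σ𝔽 (λ y → δ y w) ≡ 1#
  Σ-δ w = trans (Σ-point (λ y → δ y w) w (λ y → δ-no)) (δ-yes refl)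

  -x*-x≡x*x : ∀ x → - x * - x ≡ x * x
  -x*-x≡x*x x = trans (sym (-‿distribˡ-* x (- x)))
    (trans (cong -_ (sym (-‿distribʳ-* x x))) (-‿involutive (x * x)))

  x*x≡y*y⇒x≡±y : ∀ {x y} → x * x ≡ y * y → x ≡ y ⊎ x ≡ - y
  x*x≡y*y⇒x≡±y {x} {y} eq with x ≟ y
  ... | yes x≡y = inj₁ x≡y
  ... | no  x≢y = inj₂ (x+y≡0⇒x≡-y x y (x*y≡0⇒y≡0 (λ x-y≡0 → x≢y (x-y≡0⇒x≡y x y x-y≡0)) (begin
    (x + - y) * (x + y)              ≡⟨ expand x y (- y) ⟩
    x * x + - y * y + x * (y + - y)
      ≡⟨ cong₂ (λ s t → x * x + s + x * t) (sym (-‿distribˡ-* y y)) (-‿inverseʳ y) ⟩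
    x * x + - (y * y) + x * 0#       ≡⟨ cong₂ _+_ (x≡y⇒x-y≡0 eq) (zeroʳ x) ⟩
    0# + 0#                          ≡⟨ +-identityʳ 0# ⟩
    0#                               ∎)))
    where
    open ≡-Reasoning
    expand : ∀ x y z → (x + z) * (x + y) ≡ x * x + z * y + x * (y + z)
    expand = solve 3 (λ x y z → (x :+ z) :* (x :+ y) := x :* x :+ z :* y :+ x :* (y :+ z)) refl

  x≡-x⇒x≡0 : ∀ {x} → 1# + 1# ≢ 0# → x ≡ - x → x ≡ 0#
  x≡-x⇒x≡0 {x} 2≢0 eq = x*y≡0⇒y≡0 2≢0 (begin
    (1# + 1#) * x    ≡⟨ distribʳ x 1# 1# ⟩
    1# * x + 1# * x  ≡⟨ cong₂ _+_ (*-identityˡ x) (trans (*-identityˡ x) eq) ⟩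
    x + - x          ≡⟨ -‿inverseʳ x ⟩
    0#               ∎)
    where open ≡-Reasoning

  -- For z ≠ 0 the square of z^m is z^(q-1) = 1, so z^m is 1 or -1. In the first case `nth-root`
  -- supplies a root w, and w ≠ -w in odd characteristic gives two roots; in the second case z is
  -- not a square. The count is 1 + z^m each time, also for z = 0.
  count-square-roots : ∀ e → size ≡ suc (suc e ℕ.+ suc e) → 1# + 1# ≢ 0# → ∀ z →
    Σ𝔽 (λ y → δ (y * y) z) ≡ 1# + z ^ suc e
  count-square-roots e size≡ 2≢0 z with z ≟ 0#
  ... | yes refl = begin
    Σ𝔽 (λ y → δ (y * y) 0#)  ≡⟨ Σ-point (λ y → δ (y * y) 0#) 0# (λ y y≢0 → δ-no (*-≢0 y≢0 y≢0)) ⟩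
    δ (0# * 0#) 0#           ≡⟨ δ-yes (zeroʳ 0#) ⟩
    1#                       ≡⟨ sym (+-identityʳ 1#) ⟩
    1# + 0#                  ≡⟨ cong (1# +_) (sym (zeroˡ _)) ⟩
    1# + 0# ^ suc e          ∎
    where open ≡-Reasoning
  ... | no z≢0 with z ^ suc e ≟ 1#
  ...   | yes z^m≡1 with nth-root 1 e z size≡ (n+n≡n*2 (suc e)) z≢0 z^m≡1
  ...     | w , w²≡z′ = begin
    Σ𝔽 (λ y → δ (y * y) z)                  ≡⟨ Σ-cong two ⟩
    Σ𝔽 (λ y → δ y w + δ y (- w))            ≡⟨ Σ-distrib-+ (λ y → δ y w) (λ y → δ y (- w)) ⟩
    Σ𝔽 (λ y → δ y w) + Σ𝔽 (λ y → δ y (- w)) ≡⟨ cong₂ _+_ (Σ-δ w) (Σ-δ (- w)) ⟩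
    1# + 1#                                 ≡⟨ cong (1# +_) (sym z^m≡1) ⟩
    1# + z ^ suc e                          ∎
    where
    open ≡-Reasoning
    w²≡z : w * w ≡ z
    w²≡z = trans (cong (w *_) (sym (*-identityʳ w))) w²≡z′
    w≢-w : w ≢ - w
    w≢-w eq = z≢0 (trans (sym w²≡z) (trans (cong (_* w) (x≡-x⇒x≡0 2≢0 eq)) (zeroˡ w)))
    two : ∀ y → δ (y * y) z ≡ δ y w + δ y (- w)
    two y with y ≟ w | y ≟ - w
    ... | yes y≡w | yes y≡-w = contradiction (trans (sym y≡w) y≡-w) w≢-w
    ... | yes refl | no  _    = trans (δ-yes w²≡z) (sym (+-identityʳ 1#))
    ... | no  _    | yes refl = trans (δ-yes (trans (-x*-x≡x*x w) w²≡z)) (sym (+-identityˡ 1#))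
    ... | no  y≢w  | no y≢-w  = trans (δ-no not-root) (sym (+-identityʳ 0#))
      where
      not-root : y * y ≢ z
      not-root y²≡z with x*x≡y*y⇒x≡±y (trans y²≡z (sym w²≡z))
      ... | inj₁ y≡w  = y≢w y≡w
      ... | inj₂ y≡-w = y≢-w y≡-w
  count-square-roots e size≡ 2≢0 z | no z≢0 | no z^m≢1 = begin
    Σ𝔽 (λ y → δ (y * y) z)  ≡⟨ Σ-zero _ (λ y → δ-no (not-root y)) ⟩
    0#                      ≡⟨ sym (-‿inverseʳ 1#) ⟩
    1# + - 1#               ≡⟨ cong (1# +_) (sym z^m≡-1) ⟩
    1# + z ^ suc e          ∎
    where
    open ≡-Reasoning
    not-root : ∀ y → y * y ≢ z
    not-root y y²≡z = z^m≢1 (begin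
      z ^ suc e                  ≡⟨ cong (_^ suc e) (sym y²≡z) ⟩
      (y * y) ^ suc e            ≡⟨ ^-distrib-* y y (suc e) ⟩
      y ^ suc e * y ^ suc e      ≡⟨ sym (^-homo-* y (suc e) (suc e)) ⟩
      y ^ (suc e ℕ.+ suc e)      ≡⟨ fermat-unit size≡ (λ y≡0 → z≢0 (trans (sym y²≡z)
                                       (trans (cong (_* y) y≡0) (zeroˡ y)))) ⟩
      1#                         ∎)
    z^m≡-1 : z ^ suc e ≡ - 1#
    z^m≡-1 with x*x≡y*y⇒x≡±y (trans (sym (^-homo-* z (suc e) (suc e)))
                                    (trans (fermat-unit size≡ z≢0) (sym (*-identityʳ 1#))))
    ... | inj₁ z^m≡1  = contradiction z^m≡1 z^m≢1
    ... | inj₂ z^m≡-1 = z^m≡-1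

  -- The number of points modulo p

  fromℕ-sum : ∀ {n} (f : Fin n → ℕ) → fromℕ (sum (map f (allFin n))) ≡ Sum.sum (fromℕ ∘ f)
  fromℕ-sum {n} f = trans (cong (fromℕ ∘ sum) (map-tabulate (λ i → i) f)) (fromℕ-sum-tabulate f)
    where
    fromℕ-sum-tabulate : ∀ {n} (f : Fin n → ℕ) → fromℕ (sum (tabulate f)) ≡ Sum.sum (fromℕ ∘ f)
    fromℕ-sum-tabulate {zero}  f = refl
    fromℕ-sum-tabulate {suc n} f = trans (fromℕ-+ (f zero) _)
      (cong (fromℕ (f zero) +_) (fromℕ-sum-tabulate (f ∘ suc)))

  -- For m = (q-1)/2 this is minus the trace of Frobenius, reduced modulo p.
  hasseSum : ℕ → Carrier → Carrier → Carrier
  hasseSum m A B = Σ𝔽 (λ x → (x ^3 + A * x + B) ^ m)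

  fromℕ-indicator : ∀ A B ns x y → fromℕ (indicator F (mkEC A B ns) x y) ≡ δ (y * y) (x ^3 + A * x + B)
  fromℕ-indicator A B ns x y with (y * y) ≟ (x ^3 + A * x + B)
  ... | yes _ = +-identityʳ 1#
  ... | no  _ = refl

  -- The leading 1 is the point at infinity. Each x contributes 1 + f(x)^m, and the ones add up to q
  -- = 0.
  fromℕ-#points : ∀ e → size ≡ suc (suc e ℕ.+ suc e) → 1# + 1# ≢ 0# → ∀ A B ns →
    fromℕ (#points F (mkEC A B ns)) ≡ 1# + hasseSum (suc e) A B
  fromℕ-#points e size≡ 2≢0 A B ns = cong (1# +_) (begin
    fromℕ (sum (map (λ i → sum (map (λ j → indicator F E (to i) (to j)) (allFin size))) (allFin size)))
      ≡⟨ fromℕ-sum (λ i → sum (map (λ j → indicator F E (to i) (to j)) (allFin size))) ⟩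
    Sum.sum (λ i → fromℕ (sum (map (λ j → indicator F E (to i) (to j)) (allFin size))))
      ≡⟨ Sum.sum-cong-≗ (λ i → row (to i)) ⟩
    Σ𝔽 (λ x → 1# + (x ^3 + A * x + B) ^ suc e)
      ≡⟨ Σ-distrib-+ (λ _ → 1#) (λ x → (x ^3 + A * x + B) ^ suc e) ⟩
    Σ𝔽 (λ _ → 1#) + hasseSum (suc e) A B
      ≡⟨ trans (cong (_+ hasseSum (suc e) A B) Σ-one) (+-identityˡ _) ⟩
    hasseSum (suc e) A B ∎)
    where
    open ≡-Reasoning
    E = mkEC A B ns
    row : ∀ x → fromℕ (sum (map (λ j → indicator F E x (to j)) (allFin size))) ≡ 1# + (x ^3 + A * x + B) ^ suc e
    row x = begin
      fromℕ (sum (map (λ j → indicator F E x (to j)) (allFin size)))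
        ≡⟨ fromℕ-sum (λ j → indicator F E x (to j)) ⟩
      Σ𝔽 (λ y → fromℕ (indicator F E x y))
        ≡⟨ Σ-cong (fromℕ-indicator A B ns x) ⟩
      Σ𝔽 (λ y → δ (y * y) (x ^3 + A * x + B))
        ≡⟨ count-square-roots e size≡ 2≢0 _ ⟩
      1# + (x ^3 + A * x + B) ^ suc e ∎

  -- The scaling factor u from equal Hasse sums

  base≢0 : ∀ {u} n → u ^ suc n ≢ 0# → u ≢ 0#
  base≢0 {u} n u^n≢0 refl = u^n≢0 (zeroˡ (u ^ n))

  /-*-cancel : ∀ x {y} → y ≢ 0# → x * y ⁻¹ * y ≡ x
  /-*-cancel x {y} y≢0 = trans (*-assoc x _ y) (trans (cong (x *_) (⁻¹-inverseˡ y y≢0)) (*-identityʳ x))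

  ∃-scaling-A≡0 : ∀ e → size ≡ suc (suc e ℕ.+ suc e) → ∀ B₁ B₂ → B₁ ≢ 0# → B₂ ≢ 0# →
    hasseSum (suc e) 0# B₁ ≢ 0# → hasseSum (suc e) 0# B₂ ≡ hasseSum (suc e) 0# B₁ →
    ∃[ u ] u ≢ 0# × B₂ ≡ u ^ 6 * B₁
  ∃-scaling-A≡0 e size≡ B₁ B₂ B₁≢0 B₂≢0 H≢0 H≡ = u , base≢0 5 u^6≢0 , (begin
    B₂            ≡⟨ sym dB₁≡B₂ ⟩
    d * B₁        ≡⟨ cong (_* B₁) (sym u^6≡d) ⟩
    u ^ 6 * B₁    ∎)
    where
    open ≡-Reasoning
    m = suc e
    d = B₂ * B₁ ⁻¹
    dB₁≡B₂ : d * B₁ ≡ B₂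
    dB₁≡B₂ = /-*-cancel B₂ B₁≢0
    d≢0 : d ≢ 0#
    d≢0 = *-≢0 B₂≢0 (⁻¹-≢0 B₁≢0)
    as-twisted : ∀ B → hasseSum m 0# B ≡ twistedSum 3 B m 0
    as-twisted B = Σ-cong (λ x → trans (cong (_^ m) (begin
      x ^3 + 0# * x + B  ≡⟨ cong (λ w → x ^3 + w + B) (zeroˡ x) ⟩
      x ^3 + 0# + B      ≡⟨ cong (_+ B) (+-identityʳ _) ⟩
      x ^3 + B           ≡⟨ cong (_+ B) (solve 1 (λ x → x :* x :* x := x :^ 3) refl x) ⟩
      x ^ 3 + B          ∎)) (sym (*-identityˡ _)))
    -- 3m < 4m = 2N, strict because m is positive.
    bound : m ℕ.* 3 < (m ℕ.+ m) ℕ.+ (m ℕ.+ m)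
    bound = subst (m ℕ.* 3 <_) (n*4≡ m) (ℕ.*-monoʳ-< m (s≤s (s≤s (s≤s (s≤s z≤n)))))
    -- The surviving monomial x^(3k) B^(m-k) has 3k = 2m, so 6(m - k) = 6m - 4m = 2m = N.
    degree : ∀ k → k ≤ m → k ℕ.* 3 ≡ m ℕ.+ m → (m ℕ.∸ k) ℕ.* 6 ≡ m ℕ.+ m
    degree k _ eq = trans (ℕ.*-distribʳ-∸ 6 m k) (trans (cong₂ ℕ._∸_ (n*6≡ m)
      (trans (sym (ℕ.*-assoc k 3 2)) (cong (ℕ._* 2) eq))) (ℕ.m+n∸m≡n ((m ℕ.+ m) ℕ.* 2) (m ℕ.+ m)))
    root = twist-is-power 5 3 0 m d B₁ size≡ (λ ()) bound degree d≢0
      (λ T≡0 → H≢0 (trans (as-twisted B₁) T≡0))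
      (trans (cong (λ C → twistedSum 3 C m 0) dB₁≡B₂)
        (trans (sym (as-twisted B₂)) (trans H≡ (as-twisted B₁))))
    u = proj₁ root
    u^6≡d : u ^ 6 ≡ d
    u^6≡d = proj₂ root
    u^6≢0 : u ^ 6 ≢ 0#
    u^6≢0 eq = d≢0 (trans (sym u^6≡d) eq)

  ∃-scaling-B≡0 : ∀ e → size ≡ suc (suc e ℕ.+ suc e) → ∀ A₁ A₂ → A₁ ≢ 0# → A₂ ≢ 0# →
    hasseSum (suc e) A₁ 0# ≢ 0# → hasseSum (suc e) A₂ 0# ≡ hasseSum (suc e) A₁ 0# →
    ∃[ u ] u ≢ 0# × A₂ ≡ u ^ 4 * A₁
  ∃-scaling-B≡0 e size≡ A₁ A₂ A₁≢0 A₂≢0 H≢0 H≡ = u , base≢0 3 u^4≢0 , (begin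
    A₂            ≡⟨ sym dA₁≡A₂ ⟩
    d * A₁        ≡⟨ cong (_* A₁) (sym u^4≡d) ⟩
    u ^ 4 * A₁    ∎)
    where
    open ≡-Reasoning
    m = suc e
    d = A₂ * A₁ ⁻¹
    dA₁≡A₂ : d * A₁ ≡ A₂
    dA₁≡A₂ = /-*-cancel A₂ A₁≢0
    d≢0 : d ≢ 0#
    d≢0 = *-≢0 A₂≢0 (⁻¹-≢0 A₁≢0)
    as-twisted : ∀ A → hasseSum m A 0# ≡ twistedSum 2 A m m
    as-twisted A = Σ-cong (λ x → trans (cong (_^ m) (begin
      x ^3 + A * x + 0#  ≡⟨ +-identityʳ _ ⟩
      x ^3 + A * x       ≡⟨ solve 2 (λ x a → x :* x :* x :+ a :* x := x :* (x :^ 2 :+ a)) refl x A ⟩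
      x * (x ^ 2 + A)    ∎)) (^-distrib-* x (x ^ 2 + A) m))
    bound : m ℕ.+ m ℕ.* 2 < (m ℕ.+ m) ℕ.+ (m ℕ.+ m)
    bound = subst (_< (m ℕ.+ m) ℕ.+ (m ℕ.+ m)) (ℕ.*-suc m 2)
      (subst (m ℕ.* 3 <_) (n*4≡ m) (ℕ.*-monoʳ-< m (s≤s (s≤s (s≤s (s≤s z≤n))))))
    -- The surviving monomial x^(m+2k) A^(m-k) has 2k = m, so 4(m - k) = 4m - 2m = N.
    degree : ∀ k → k ≤ m → m ℕ.+ k ℕ.* 2 ≡ m ℕ.+ m → (m ℕ.∸ k) ℕ.* 4 ≡ m ℕ.+ m
    degree k _ eq = trans (ℕ.*-distribʳ-∸ 4 m k) (trans (cong₂ ℕ._∸_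
      (trans (n*4≡ m) (cong (ℕ._+ (m ℕ.+ m)) (n+n≡n*2 m)))
      (trans (sym (ℕ.*-assoc k 2 2)) (cong (ℕ._* 2) (ℕ.+-cancelˡ-≡ m _ _ eq)))) (ℕ.m+n∸m≡n (m ℕ.* 2) (m ℕ.+ m)))
    root = twist-is-power 3 2 m m d A₁ size≡ (λ ()) bound degree d≢0
      (λ T≡0 → H≢0 (trans (as-twisted A₁) T≡0))
      (trans (cong (λ C → twistedSum 2 C m m) dA₁≡A₂)
        (trans (sym (as-twisted A₂)) (trans H≡ (as-twisted A₁))))
    u = proj₁ root
    u^4≡d : u ^ 4 ≡ d
    u^4≡d = proj₂ root
    u^4≢0 : u ^ 4 ≢ 0#
    u^4≢0 eq = d≢0 (trans (sym u^4≡d) eq)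

  -- Substituting v x for x takes v³ out of the cubic. The factor stays split into three powers v^m,
  -- two of which form v^(q-1) = 1.
  hasseSum-scale : ∀ m v A B → v ≢ 0# →
    hasseSum m (v * v * A) (v * v * v * B) ≡ (v ^ m * v ^ m * v ^ m) * hasseSum m A B
  hasseSum-scale m v A B v≢0 = begin
    Σ𝔽 (λ x → (x ^3 + v * v * A * x + v * v * v * B) ^ m)
      ≡⟨ Σ-reindex (λ x → (x ^3 + v * v * A * x + v * v * v * B) ^ m) (*-↔ v v≢0) ⟩
    Σ𝔽 (λ x → ((v * x) ^3 + v * v * A * (v * x) + v * v * v * B) ^ m)
      ≡⟨ Σ-cong (λ x → trans (cong (_^ m) (factor v x A B)) (trans (^-distrib-* _ _ m)
           (cong (_* (x ^3 + A * x + B) ^ m)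
             (trans (^-distrib-* (v * v) v m) (cong (_* v ^ m) (^-distrib-* v v m)))))) ⟩
    Σ𝔽 (λ x → (v ^ m * v ^ m * v ^ m) * (x ^3 + A * x + B) ^ m)
      ≡⟨ sym (*-distribˡ-Σ _ (λ x → (x ^3 + A * x + B) ^ m)) ⟩
    (v ^ m * v ^ m * v ^ m) * hasseSum m A B ∎
    where
    open ≡-Reasoning
    factor : ∀ v x A B → (v * x) ^3 + v * v * A * (v * x) + v * v * v * B ≡ v * v * v * (x ^3 + A * x + B)
    factor = solve 4 (λ v x A B →
      (v :* x) :* (v :* x) :* (v :* x) :+ v :* v :* A :* (v :* x) :+ v :* v :* v :* B
      := v :* v :* v :* (x :* x :* x :+ A :* x :+ B)) refl

  ∃-scaling-generic : ∀ e → size ≡ suc (suc e ℕ.+ suc e) → ∀ A₁ B₁ A₂ B₂ →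
    A₁ ≢ 0# → B₁ ≢ 0# → A₂ ≢ 0# → B₂ ≢ 0# → A₁ ^3 * B₂ ^2 ≡ A₂ ^3 * B₁ ^2 →
    hasseSum (suc e) A₁ B₁ ≢ 0# → hasseSum (suc e) A₂ B₂ ≡ hasseSum (suc e) A₁ B₁ →
    ∃[ u ] u ≢ 0# × A₂ ≡ u ^ 4 * A₁ × B₂ ≡ u ^ 6 * B₁
  ∃-scaling-generic e size≡ A₁ B₁ A₂ B₂ A₁≢0 B₁≢0 A₂≢0 B₂≢0 cross H≢0 H≡ = u , base≢0 1 u²≢0 , (begin
    A₂                       ≡⟨ A₂≡v²A₁ ⟩
    v * v * A₁               ≡⟨ cong (λ w → w * w * A₁) (sym u²≡v) ⟩
    u ^ 2 * u ^ 2 * A₁       ≡⟨ solve 2 (λ u a → u :^ 2 :* u :^ 2 :* a := u :^ 4 :* a) refl u A₁ ⟩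
    u ^ 4 * A₁               ∎) , (begin
    B₂                           ≡⟨ B₂≡v³B₁ ⟩
    v * v * v * B₁               ≡⟨ cong (λ w → w * w * w * B₁) (sym u²≡v) ⟩
    u ^ 2 * u ^ 2 * u ^ 2 * B₁
      ≡⟨ solve 2 (λ u b → u :^ 2 :* u :^ 2 :* u :^ 2 :* b := u :^ 6 :* b) refl u B₁ ⟩
    u ^ 6 * B₁                   ∎)
    where
    open ≡-Reasoning
    m = suc e
    w = B₁ * A₂
    w≢0 : w ≢ 0#
    w≢0 = *-≢0 B₁≢0 A₂≢0
    -- The only candidate: A₂ = v²A₁ and B₂ = v³B₁ force v = (B₂/B₁)/(A₂/A₁).
    v = (B₂ * A₁) * w ⁻¹
    v≢0 : v ≢ 0#
    v≢0 = *-≢0 (*-≢0 B₂≢0 A₁≢0) (⁻¹-≢0 w≢0)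
    vw≡B₂A₁ : v * w ≡ B₂ * A₁
    vw≡B₂A₁ = /-*-cancel (B₂ * A₁) w≢0
    A₂≡v²A₁ : A₂ ≡ v * v * A₁
    -- Multiplied by w² = B₁²A₂², the two sides become A₂³B₁² and, by v w = B₂A₁, A₁³B₂².
    A₂≡v²A₁ = *-cancelˡ (w * w) (*-≢0 w≢0 w≢0) (begin
      w * w * A₂
        ≡⟨ solve 2 (λ a b → (b :* a) :* (b :* a) :* a := (a :* a :* a) :* (b :* b)) refl A₂ B₁ ⟩
      A₂ ^3 * B₁ ^2               ≡⟨ sym cross ⟩
      A₁ ^3 * B₂ ^2
        ≡⟨ solve 2 (λ a b → (a :* a :* a) :* (b :* b) := (b :* a) :* (b :* a) :* a) refl A₁ B₂ ⟩
      B₂ * A₁ * (B₂ * A₁) * A₁    ≡⟨ cong (λ z → z * z * A₁) (sym vw≡B₂A₁) ⟩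
      v * w * (v * w) * A₁
        ≡⟨ solve 3 (λ v w a → v :* w :* (v :* w) :* a := w :* w :* (v :* v :* a)) refl v w A₁ ⟩
      w * w * (v * v * A₁)        ∎)
    B₂≡v³B₁ : B₂ ≡ v * v * v * B₁
    B₂≡v³B₁ = *-cancelˡ A₁ A₁≢0 (begin
      A₁ * B₂                     ≡⟨ *-comm A₁ B₂ ⟩
      B₂ * A₁                     ≡⟨ sym vw≡B₂A₁ ⟩
      v * (B₁ * A₂)               ≡⟨ cong (λ z → v * (B₁ * z)) A₂≡v²A₁ ⟩
      v * (B₁ * (v * v * A₁))
        ≡⟨ solve 3 (λ v a b → v :* (b :* (v :* v :* a)) := a :* (v :* v :* v :* b)) refl v A₁ B₁ ⟩
      A₁ * (v * v * v * B₁)       ∎)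
    v^m≡1 : v ^ m ≡ 1#
    v^m≡1 = *-cancelˡ (hasseSum m A₁ B₁) H≢0 (begin
      H * v ^ m                                  ≡⟨ *-comm _ _ ⟩
      v ^ m * H                                  ≡⟨ cong (λ z → z * H) (sym (*-identityˡ _)) ⟩
      1# * v ^ m * H                             ≡⟨ cong (λ z → z * v ^ m * H) (sym
                                                      (trans (sym (^-homo-* v m m)) (fermat-unit size≡ v≢0))) ⟩
      v ^ m * v ^ m * v ^ m * H                  ≡⟨ sym (hasseSum-scale m v A₁ B₁ v≢0) ⟩
      hasseSum m (v * v * A₁) (v * v * v * B₁)   ≡⟨ sym (cong₂ (hasseSum m) A₂≡v²A₁ B₂≡v³B₁) ⟩
      hasseSum m A₂ B₂                           ≡⟨ H≡ ⟩
      H                                          ≡⟨ sym (*-identityʳ H) ⟩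
      H * 1#                                     ∎)
      where H = hasseSum m A₁ B₁
    root = nth-root 1 e v size≡ (n+n≡n*2 m) v≢0 v^m≡1
    u = proj₁ root
    u²≡v : u ^ 2 ≡ v
    u²≡v = proj₂ root
    u²≢0 : u ^ 2 ≢ 0#
    u²≢0 eq = v≢0 (trans (sym u²≡v) eq)

  fromℕ∘suc≡1⇒≡0 : ∀ n → fromℕ (suc n) ≡ 1# → fromℕ n ≡ 0#
  fromℕ∘suc≡1⇒≡0 n eq = +-cancelˡ 1# _ _ (trans eq (sym (+-identityʳ 1#)))

-- Consequences of the characteristic being a prime p other than 2 and 3

prime∣^⇒∣ : ∀ {q} → Prime q → ∀ n r → q ∣ n ℕ.^ r → q ∣ n
prime∣^⇒∣ {q} q-prime n zero q∣1 = contradiction (subst Prime (∣1⇒≡1 q∣1) q-prime) ¬prime[1]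
prime∣^⇒∣ {q} q-prime n (suc r) q∣n^r with euclidsLemma n (n ℕ.^ r) q-prime q∣n^r
... | inj₁ q∣n  = q∣n
... | inj₂ q∣n^ = prime∣^⇒∣ q-prime n r q∣n^

prime∣prime⇒≡ : ∀ {p q} → Prime p → Prime q → p ∣ q → p ≡ q
prime∣prime⇒≡ p-prime q-prime p∣q with prime⇒irreducible q-prime p∣q
... | inj₁ refl = contradiction p-prime ¬prime[1]
... | inj₂ p≡q  = p≡q

parity : ∀ n → (∃[ k ] n ≡ k ℕ.+ k) ⊎ (∃[ k ] n ≡ suc (k ℕ.+ k))
parity zero    = inj₁ (0 , refl)
parity (suc n) with parity n
... | inj₁ (k , refl) = inj₂ (k , refl)
... | inj₂ (k , refl) = inj₁ (suc k , cong suc (sym (ℕ.+-suc k k)))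

module Characteristic (F : FiniteField) (p : ℕ) (p-prime : Prime p) (p≢2 : p ≢ 2) (p≢3 : p ≢ 3)
  (r : ℕ) (size≡p^r : FiniteField.size F ≡ p ℕ.^ r) where
  open FieldTheory F

  bézout-collapse : ∀ x y {p n} → fromℕ p ≡ 0# → fromℕ n ≡ 0# → suc (y ℕ.* n) ≡ x ℕ.* p → 1# ≡ 0#
  bézout-collapse x y {p} {n} p≡0 n≡0 eq = begin
    1#
      ≡⟨ sym (trans (cong (1# +_) (trans (cong (fromℕ y *_) n≡0) (zeroʳ _))) (+-identityʳ 1#)) ⟩
    1# + fromℕ y * fromℕ n        ≡⟨ cong (1# +_) (sym (fromℕ-* y n)) ⟩
    fromℕ (suc (y ℕ.* n))         ≡⟨ cong fromℕ eq ⟩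
    fromℕ (x ℕ.* p)               ≡⟨ fromℕ-* x p ⟩
    fromℕ x * fromℕ p             ≡⟨ trans (cong (fromℕ x *_) p≡0) (zeroʳ _) ⟩
    0#                            ∎
    where open ≡-Reasoning

  -- The power p^r = q is zero in the field, and a field has no nonzero nilpotents.
  fromℕ-p : fromℕ p ≡ 0#
  fromℕ-p = decidable-stable (fromℕ p ≟ 0#) λ p≢0 →
    ^-≢0 r p≢0 (trans (sym (fromℕ-^ p r)) (trans (cong fromℕ (sym size≡p^r)) fromℕ-size))

  -- Otherwise p and n are coprime, and a Bézout relation between two numbers that vanish in the
  -- field makes 1 vanish.
  fromℕ≡0⇒p∣ : ∀ n → fromℕ n ≡ 0# → p ∣ n
  fromℕ≡0⇒p∣ n n≡0 with p ∣? n
  ... | yes p∣n = p∣n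
  ... | no  p∤n with coprime-Bézout coprime
    where
    coprime : Coprime p n
    coprime (d∣p , d∣n) with prime⇒irreducible p-prime d∣p
    ... | inj₁ d≡1  = d≡1
    ... | inj₂ refl = contradiction d∣n p∤n
  ...   | Bézout.+- x y eq = contradiction (bézout-collapse x y fromℕ-p n≡0 eq) 1≢0
  fromℕ≡0⇒p∣ n n≡0 | no p∤n | Bézout.-+ x y eq = contradiction (bézout-collapse y x n≡0 fromℕ-p eq) 1≢0

  -- Covers the integer constants that have to be cancelled: 2, 4, 27 and 1728 = 2^6 · 3^3.
  p∤2^i*3^j : ∀ i j → ¬ p ∣ 2 ℕ.^ i ℕ.* 3 ℕ.^ j
  p∤2^i*3^j i j p∣ with euclidsLemma (2 ℕ.^ i) (3 ℕ.^ j) p-prime p∣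
  ... | inj₁ p∣2^i = p≢2 (prime∣prime⇒≡ p-prime (prime[2]) (prime∣^⇒∣ p-prime 2 i p∣2^i))
  ... | inj₂ p∣3^j = p≢3 (prime∣prime⇒≡ p-prime (from-yes (prime? 3)) (prime∣^⇒∣ p-prime 3 j p∣3^j))

  2^i*3^j≢0 : ∀ i j → fromℕ (2 ℕ.^ i ℕ.* 3 ℕ.^ j) ≢ 0#
  2^i*3^j≢0 i j eq = p∤2^i*3^j i j (fromℕ≡0⇒p∣ _ eq)

  2≢0 : fromℕ 2 ≢ 0#
  2≢0 = 2^i*3^j≢0 1 0

  1+1≢0 : 1# + 1# ≢ 0#
  1+1≢0 eq = 2≢0 (trans (cong (1# +_) (+-identityʳ 1#)) eq)

  -- Provides m = (q-1)/2 in the form `suc e`, so that its positivity is built in; q = 1 is excluded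
  -- because 0 ≠ 1.
  size-odd : ∃[ e ] size ≡ suc (suc e ℕ.+ suc e)
  size-odd with parity size
  ... | inj₁ (k , size≡) = contradiction
    (prime∣prime⇒≡ (prime[2]) p-prime (prime∣^⇒∣ (prime[2]) p r
      (divides k (trans (sym size≡p^r) (trans size≡ (n+n≡n*2 k))))))
    (λ 2≡p → p≢2 (sym 2≡p))
  ... | inj₂ (zero , size≡) = contradiction
    (trans (sym (+-identityʳ 1#)) (trans (cong fromℕ (sym size≡)) fromℕ-size)) 1≢0
  ... | inj₂ (suc e , size≡) = e , size≡

  ordinary⇒hasseSum≢0 : .{{_ : NonZero p}} → ∀ e → size ≡ suc (suc e ℕ.+ suc e) → ∀ A B ns →
    Ordinary F p (mkEC A B ns) → hasseSum (suc e) A B ≢ 0#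
  ordinary⇒hasseSum≢0 e size≡ A B ns ordinary H≡0 =
    -- The predecessor of `#points` is the number of affine points; if H = 0, it is zero in the
    -- field and hence a multiple of p.
    ordinary (supersingular (fromℕ≡0⇒p∣ _ (fromℕ∘suc≡1⇒≡0 (ℕ.pred (#points F (mkEC A B ns)))
      (trans (fromℕ-#points e size≡ 1+1≢0 A B ns) (trans (cong (1# +_) H≡0) (+-identityʳ 1#))))))
    where
    supersingular : ∀ {n} → p ∣ n → suc n % p ≡ 1 % p
    supersingular (divides k refl) = [m+kn]%n≡m%n 1 k p

  #points≡⇒hasseSum≡ : ∀ e → size ≡ suc (suc e ℕ.+ suc e) → ∀ A₁ B₁ ns₁ A₂ B₂ ns₂ →
    #points F (mkEC A₁ B₁ ns₁) ≡ #points F (mkEC A₂ B₂ ns₂) → hasseSum (suc e) A₂ B₂ ≡ hasseSum (suc e) A₁ B₁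
  #points≡⇒hasseSum≡ e size≡ A₁ B₁ ns₁ A₂ B₂ ns₂ eq = +-cancelˡ 1# _ _
    (trans (sym (fromℕ-#points e size≡ 1+1≢0 A₂ B₂ ns₂))
      (trans (cong fromℕ (sym eq)) (fromℕ-#points e size≡ 1+1≢0 A₁ B₁ ns₁)))

  -- From equal j-invariants and equal counts to a scaling

  -- After the denominators are cleared, both sides contain the symmetric term 4 A₁³A₂³; cancelling
  -- it and the constants leaves the mixed terms. A relation without quotients also covers vanishing
  -- coefficients.
  jInvariant≡⇒ : ∀ A₁ B₁ ns₁ A₂ B₂ ns₂ → jInvariant F (mkEC A₁ B₁ ns₁) ≡ jInvariant F (mkEC A₂ B₂ ns₂) →
    A₁ ^3 * B₂ ^2 ≡ A₂ ^3 * B₁ ^2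
  jInvariant≡⇒ A₁ B₁ ns₁ A₂ B₂ ns₂ j≡ =
    *-cancelˡ k₂₇ (2^i*3^j≢0 0 3) (+-cancelˡ (k₄ * a₁ * a₂) _ _
      (*-cancelˡ k₄ (2^i*3^j≢0 2 0) (*-cancelˡ k (2^i*3^j≢0 6 3) (begin
        k * (k₄ * (k₄ * a₁ * a₂ + k₂₇ * (a₁ * b₂)))  ≡⟨ left k k₄ k₂₇ a₁ a₂ b₂ ⟩
        k * (k₄ * a₁) * D₂                           ≡⟨ cross ⟩
        k * (k₄ * a₂) * D₁                           ≡⟨ right k k₄ k₂₇ a₁ a₂ b₁ ⟩
        k * (k₄ * (k₄ * a₁ * a₂ + k₂₇ * (a₂ * b₁)))  ∎))))
    where
    open ≡-Reasoning
    k = fromℕ 1728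
    k₄ = fromℕ 4
    k₂₇ = fromℕ 27
    a₁ = A₁ ^3
    a₂ = A₂ ^3
    b₁ = B₁ ^2
    b₂ = B₂ ^2
    D₁ = discr F A₁ B₁
    D₂ = discr F A₂ B₂
    left : ∀ k f t a c b → k * (f * (f * a * c + t * (a * b))) ≡ k * (f * a) * (f * c + t * b)
    left = solve 6 (λ k f t a c b → k :* (f :* (f :* a :* c :+ t :* (a :* b)))
         := k :* (f :* a) :* (f :* c :+ t :* b)) refl
    right : ∀ k f t a c b → k * (f * c) * (f * a + t * b) ≡ k * (f * (f * a * c + t * (c * b)))
    right = solve 6 (λ k f t a c b → k :* (f :* c) :* (f :* a :+ t :* b)
         := k :* (f :* (f :* a :* c :+ t :* (c :* b)))) refl
    clear : ∀ n D E → D ≢ 0# → n * E ≡ n * D ⁻¹ * (D * E)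
    clear n D E D≢0 = begin
      n * E                  ≡⟨ sym (*-identityʳ _) ⟩
      n * E * 1#             ≡⟨ cong (n * E *_) (sym (⁻¹-inverse D D≢0)) ⟩
      n * E * (D * D ⁻¹)
        ≡⟨ solve 4 (λ n e d i → n :* e :* (d :* i) := n :* i :* (d :* e)) refl n E D (D ⁻¹) ⟩
      n * D ⁻¹ * (D * E)     ∎
    cross : k * (k₄ * a₁) * D₂ ≡ k * (k₄ * a₂) * D₁
    cross = begin
      k * (k₄ * a₁) * D₂                 ≡⟨ clear _ D₁ D₂ ns₁ ⟩
      k * (k₄ * a₁) * D₁ ⁻¹ * (D₁ * D₂)  ≡⟨ cong₂ _*_ j≡ (*-comm D₁ D₂) ⟩
      k * (k₄ * a₂) * D₂ ⁻¹ * (D₂ * D₁)  ≡⟨ sym (clear _ D₂ D₁ ns₂) ⟩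
      k * (k₄ * a₂) * D₁                 ∎

  -- The cross relation and nonsingularity make A₁ and A₂ vanish together, and likewise B₁ and B₂.
  -- So both curves always fall into the same one of the three cases.
  equal-j∧#points⇒scaling : .{{_ : NonZero p}} → ∀ A₁ B₁ ns₁ A₂ B₂ ns₂ → Ordinary F p (mkEC A₁ B₁ ns₁) →
    jInvariant F (mkEC A₁ B₁ ns₁) ≡ jInvariant F (mkEC A₂ B₂ ns₂) →
    #points F (mkEC A₁ B₁ ns₁) ≡ #points F (mkEC A₂ B₂ ns₂) →
    ∃[ u ] u ≢ 0# × A₂ ≡ u ^ 4 * A₁ × B₂ ≡ u ^ 6 * B₁
  equal-j∧#points⇒scaling A₁ B₁ ns₁ A₂ B₂ ns₂ ordinary j≡ #≡ with size-odd
  ... | e , size≡ = cases (A₁ ≟ 0#) (B₁ ≟ 0#)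
    where
    H≢0 : hasseSum (suc e) A₁ B₁ ≢ 0#
    H≢0 = ordinary⇒hasseSum≢0 e size≡ A₁ B₁ ns₁ ordinary
    H≡ : hasseSum (suc e) A₂ B₂ ≡ hasseSum (suc e) A₁ B₁
    H≡ = #points≡⇒hasseSum≡ e size≡ A₁ B₁ ns₁ A₂ B₂ ns₂ #≡
    cross : A₁ ^3 * B₂ ^2 ≡ A₂ ^3 * B₁ ^2
    cross = jInvariant≡⇒ A₁ B₁ ns₁ A₂ B₂ ns₂ j≡
    0^3≡0 : 0# ^3 ≡ 0#
    0^3≡0 = zeroʳ _
    0^2≡0 : 0# ^2 ≡ 0#
    0^2≡0 = zeroʳ _
    discr00≡0 : discr F 0# 0# ≡ 0#
    discr00≡0 = trans (cong₂ (λ s t → fromℕ 4 * s + fromℕ 27 * t) 0^3≡0 0^2≡0)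
      (trans (cong₂ _+_ (zeroʳ _) (zeroʳ _)) (+-identityʳ 0#))
    singular : ∀ {A B} → A ≡ 0# → B ≡ 0# → discr F A B ≡ 0#
    singular refl refl = discr00≡0
    square-factor≡0 : ∀ {x z} → z ≢ 0# → x ^3 * z ^2 ≡ 0# → x ≡ 0#
    square-factor≡0 {x} {z} z≢0 eq = decidable-stable (x ≟ 0#) λ x≢0 →
      *-≢0 (*-≢0 (*-≢0 x≢0 x≢0) x≢0) (*-≢0 z≢0 z≢0) eq
    cube-factor≡0 : ∀ {x z} → z ≢ 0# → z ^3 * x ^2 ≡ 0# → x ≡ 0#
    cube-factor≡0 {x} {z} z≢0 eq = decidable-stable (x ≟ 0#) λ x≢0 →
      *-≢0 (*-≢0 (*-≢0 z≢0 z≢0) z≢0) (*-≢0 x≢0 x≢0) eq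
    0^3*≡0 : ∀ z → 0# ^3 * z ≡ 0#
    0^3*≡0 z = trans (cong (_* z) 0^3≡0) (zeroˡ z)
    *0^2≡0 : ∀ z → z * 0# ^2 ≡ 0#
    *0^2≡0 z = trans (cong (z *_) 0^2≡0) (zeroʳ z)
    cases : Dec (A₁ ≡ 0#) → Dec (B₁ ≡ 0#) → ∃[ u ] u ≢ 0# × A₂ ≡ u ^ 4 * A₁ × B₂ ≡ u ^ 6 * B₁
    cases (yes A₁≡0) (yes B₁≡0) = contradiction (singular A₁≡0 B₁≡0) ns₁
    cases (yes A₁≡0) (no B₁≢0) =
      let A₂≡0 = square-factor≡0 B₁≢0 (trans (sym cross)
                   (trans (cong (λ a → a ^3 * B₂ ^2) A₁≡0) (0^3*≡0 _)))
          (u , u≢0 , B≡) = ∃-scaling-A≡0 e size≡ B₁ B₂ B₁≢0 (λ B₂≡0 → ns₂ (singular A₂≡0 B₂≡0))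
            (subst (λ a → hasseSum (suc e) a B₁ ≢ 0#) A₁≡0 H≢0)
            (trans (cong (λ a → hasseSum (suc e) a B₂) (sym A₂≡0))
              (trans H≡ (cong (λ a → hasseSum (suc e) a B₁) A₁≡0)))
      in u , u≢0 , trans A₂≡0 (sym (trans (cong (u ^ 4 *_) A₁≡0) (zeroʳ _))) , B≡
    cases (no A₁≢0) (yes B₁≡0) =
      let B₂≡0 = cube-factor≡0 A₁≢0 (trans cross
                   (trans (cong (λ b → A₂ ^3 * b ^2) B₁≡0) (*0^2≡0 _)))
          (u , u≢0 , A≡) = ∃-scaling-B≡0 e size≡ A₁ A₂ A₁≢0 (λ A₂≡0 → ns₂ (singular A₂≡0 B₂≡0))
            (subst (λ b → hasseSum (suc e) A₁ b ≢ 0#) B₁≡0 H≢0)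
            (trans (cong (hasseSum (suc e) A₂) (sym B₂≡0))
              (trans H≡ (cong (hasseSum (suc e) A₁) B₁≡0)))
      in u , u≢0 , A≡ , trans B₂≡0 (sym (trans (cong (u ^ 6 *_) B₁≡0) (zeroʳ _)))
    cases (no A₁≢0) (no B₁≢0) =
      ∃-scaling-generic e size≡ A₁ B₁ A₂ B₂ A₁≢0 B₁≢0 A₂≢0 B₂≢0 cross H≢0 H≡
      where
      A₂≡0⇒B₂≡0 : A₂ ≡ 0# → B₂ ≡ 0#
      A₂≡0⇒B₂≡0 A₂≡0 = cube-factor≡0 A₁≢0 (trans cross
        (trans (cong (λ a → a ^3 * B₁ ^2) A₂≡0) (0^3*≡0 _)))
      B₂≡0⇒A₂≡0 : B₂ ≡ 0# → A₂ ≡ 0#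
      B₂≡0⇒A₂≡0 B₂≡0 = square-factor≡0 B₁≢0 (trans (sym cross)
        (trans (cong (λ b → A₁ ^3 * b ^2) B₂≡0) (*0^2≡0 _)))
      A₂≢0 : A₂ ≢ 0#
      A₂≢0 A₂≡0 = ns₂ (singular A₂≡0 (A₂≡0⇒B₂≡0 A₂≡0))
      B₂≢0 : B₂ ≢ 0#
      B₂≢0 B₂≡0 = ns₂ (singular (B₂≡0⇒A₂≡0 B₂≡0) B₂≡0)

-- The isomorphism given by scaling the coordinates

module Isomorphism (F : FiniteField) where
  open FieldTheory F
  open EllipticCurve

  -- By Hedberg's theorem decidable equality makes the curve equation proof-irrelevant, so a point
  -- is determined by its coordinates.
  onCurve-irrelevant : ∀ E P (h h′ : OnCurve F E P) → h ≡ h′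
  onCurve-irrelevant E nothing        _ _ = refl
  onCurve-irrelevant E (just (x , y)) h h′ = Axiom.UniquenessOfIdentityProofs.Decidable⇒UIP.≡-irrelevant _≟_ h h′

  point-≡ : ∀ E {P Q : Point F E} → proj₁ P ≡ proj₁ Q → P ≡ Q
  point-≡ E {P , h} {.P , h′} refl = cong (P ,_) (onCurve-irrelevant E P h h′)

  scale : Carrier → RawPoint F → RawPoint F
  scale u nothing        = nothing
  scale u (just (x , y)) = just (u ^ 2 * x , u ^ 3 * y)

  scale-onCurve : ∀ u E₁ E₂ → A E₂ ≡ u ^ 4 * A E₁ → B E₂ ≡ u ^ 6 * B E₁ →
    ∀ P → OnCurve F E₁ P → OnCurve F E₂ (scale u P)
  scale-onCurve u E₁ E₂ A≡ B≡ nothing        _ = _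
  scale-onCurve u E₁ E₂ A≡ B≡ (just (x , y)) h = begin
    (u ^ 3 * y) * (u ^ 3 * y)                              ≡⟨ left u y ⟩
    u ^ 6 * (y * y)                                        ≡⟨ cong (u ^ 6 *_) h ⟩
    u ^ 6 * (x ^3 + A E₁ * x + B E₁)                       ≡⟨ right u x (A E₁) (B E₁) ⟩
    (u ^ 2 * x) ^3 + u ^ 4 * A E₁ * (u ^ 2 * x) + u ^ 6 * B E₁
      ≡⟨ cong₂ (λ a b → (u ^ 2 * x) ^3 + a * (u ^ 2 * x) + b) (sym A≡) (sym B≡) ⟩
    (u ^ 2 * x) ^3 + A E₂ * (u ^ 2 * x) + B E₂             ∎
    where
    open ≡-Reasoning
    left : ∀ u y → (u ^ 3 * y) * (u ^ 3 * y) ≡ u ^ 6 * (y * y)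
    left = solve 2 (λ u y → (u :^ 3 :* y) :* (u :^ 3 :* y) := u :^ 6 :* (y :* y)) refl
    right : ∀ u x a b → u ^ 6 * (x ^3 + a * x + b) ≡ (u ^ 2 * x) ^3 + u ^ 4 * a * (u ^ 2 * x) + u ^ 6 * b
    right = solve 4 (λ u x a b → u :^ 6 :* (x :* x :* x :+ a :* x :+ b) :=
      (u :^ 2 :* x) :* (u :^ 2 :* x) :* (u :^ 2 :* x) :+ u :^ 4 :* a :* (u :^ 2 :* x) :+ u :^ 6 :* b) refl

  -- Serves the coefficients with n = 4 and 6 and the coordinates with n = 2 and 3.
  inverse-scaling : ∀ {u v a b} n → v * u ≡ 1# → b ≡ u ^ n * a → a ≡ v ^ n * b
  inverse-scaling {u} {v} {a} {b} n vu≡1 b≡ = sym (begin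
    v ^ n * b            ≡⟨ cong (v ^ n *_) b≡ ⟩
    v ^ n * (u ^ n * a)  ≡⟨ sym (*-assoc _ _ a) ⟩
    v ^ n * u ^ n * a    ≡⟨ cong (_* a) (sym (^-distrib-* v u n)) ⟩
    (v * u) ^ n * a      ≡⟨ cong (λ w → w ^ n * a) vu≡1 ⟩
    1# ^ n * a           ≡⟨ cong (_* a) (1^n≡1 n) ⟩
    1# * a               ≡⟨ *-identityˡ a ⟩
    a                    ∎)
    where open ≡-Reasoning

  scale-inverse : ∀ {u v} → v * u ≡ 1# → ∀ P → scale v (scale u P) ≡ P
  scale-inverse vu≡1 nothing        = refl
  scale-inverse vu≡1 (just (x , y)) = sym
    (cong₂ (λ x y → just (x , y)) (inverse-scaling 2 vu≡1 refl) (inverse-scaling 3 vu≡1 refl))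

  -- Slopes scale by u: the numerator has one factor u more than the denominator. Here c is u³ for
  -- tangents and u² for chords.
  scale-slope : ∀ u c N D → c ≢ 0# → D ≢ 0# → (c * u * N) * (c * D) ⁻¹ ≡ u * (N * D ⁻¹)
  scale-slope u c N D c≢0 D≢0 = *-cancelˡ (c * D) (*-≢0 c≢0 D≢0) (begin
    c * D * (c * u * N * (c * D) ⁻¹)
      ≡⟨ solve 3 (λ d n i → d :* (n :* i) := n :* (d :* i)) refl (c * D) (c * u * N) ((c * D) ⁻¹) ⟩
    c * u * N * (c * D * (c * D) ⁻¹)    ≡⟨ cong (c * u * N *_) (⁻¹-inverse (c * D) (*-≢0 c≢0 D≢0)) ⟩
    c * u * N * 1#                      ≡⟨ cong (c * u * N *_) (sym (⁻¹-inverse D D≢0)) ⟩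
    c * u * N * (D * D ⁻¹)
      ≡⟨ solve 5 (λ c u n d i → c :* u :* n :* (d :* i) := c :* d :* (u :* (n :* i))) refl c u N D (D ⁻¹) ⟩
    c * D * (u * (N * D ⁻¹))            ∎)
    where open ≡-Reasoning

  scale-chord : ∀ u l x₁ y₁ x₂ →
    chord F (u * l) (u ^ 2 * x₁) (u ^ 3 * y₁) (u ^ 2 * x₂) ≡ scale u (chord F l x₁ y₁ x₂)
  scale-chord u l x₁ y₁ x₂ = cong₂ (λ x y → just (x , y)) x₃≡ (begin
    u * l * (u ^ 2 * x₁ + - x₃′) + - (u ^ 3 * y₁)
      ≡⟨ cong₂ (λ s t → u * l * (u ^ 2 * x₁ + s) + t) (trans (cong -_ x₃≡) (-‿distribʳ-* _ x₃)) (-‿distribʳ-* _ y₁) ⟩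
    u * l * (u ^ 2 * x₁ + u ^ 2 * - x₃) + u ^ 3 * - y₁
      ≡⟨ solve 5 (λ u l x s t → u :* l :* (u :^ 2 :* x :+ u :^ 2 :* s) :+ u :^ 3 :* t
           := u :^ 3 :* (l :* (x :+ s) :+ t)) refl u l x₁ (- x₃) (- y₁) ⟩
    u ^ 3 * (l * (x₁ + - x₃) + - y₁) ∎)
    where
    open ≡-Reasoning
    x₃ = l ^2 + - x₁ + - x₂
    x₃′ = (u * l) ^2 + - (u ^ 2 * x₁) + - (u ^ 2 * x₂)
    x₃≡ : x₃′ ≡ u ^ 2 * x₃
    x₃≡ = begin
      (u * l) ^2 + - (u ^ 2 * x₁) + - (u ^ 2 * x₂)
        ≡⟨ cong₂ (λ s t → (u * l) ^2 + s + t) (-‿distribʳ-* _ x₁) (-‿distribʳ-* _ x₂) ⟩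
      (u * l) ^2 + u ^ 2 * - x₁ + u ^ 2 * - x₂
        ≡⟨ solve 4 (λ u l s t → (u :* l) :* (u :* l) :+ u :^ 2 :* s :+ u :^ 2 :* t
             := u :^ 2 :* (l :* l :+ s :+ t)) refl u l (- x₁) (- x₂) ⟩
      u ^ 2 * x₃                                     ∎

  -- Scaling is injective and commutes with negation, so both additions take the same branch. The
  -- curve equations enter in the tangent case, where the denominator 2 y₁ must be shown nonzero.
  scale-addRaw : ∀ u E₁ E₂ → fromℕ 2 ≢ 0# → u ≢ 0# → A E₂ ≡ u ^ 4 * A E₁ →
    ∀ P Q → OnCurve F E₁ P → OnCurve F E₁ Q →
    scale u (addRaw F E₁ P Q) ≡ addRaw F E₂ (scale u P) (scale u Q)
  scale-addRaw u E₁ E₂ 2≢0 u≢0 A≡ nothing         Q               _  _  = refl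
  scale-addRaw u E₁ E₂ 2≢0 u≢0 A≡ (just _)        nothing         _  _  = refl
  scale-addRaw u E₁ E₂ 2≢0 u≢0 A≡ (just (x₁ , y₁)) (just (x₂ , y₂)) h₁ h₂
    with x₁ ≟ x₂ | y₁ ≟ - y₂ | u ^ 2 * x₁ ≟ u ^ 2 * x₂ | u ^ 3 * y₁ ≟ - (u ^ 3 * y₂)
  ... | yes _     | yes _     | yes _    | yes _    = refl
  ... | yes x₁≡x₂ | _         | no x≢    | _        = contradiction (cong (u ^ 2 *_) x₁≡x₂) x≢
  ... | no x₁≢x₂  | _         | yes x≡   | _        = contradiction (*-cancelˡ (u ^ 2) (^-≢0 2 u≢0) x≡) x₁≢x₂
  ... | yes _     | yes y₁≡   | yes _    | no y≢    =
    contradiction (trans (cong (u ^ 3 *_) y₁≡) (sym (-‿distribʳ-* (u ^ 3) y₂))) y≢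
  ... | yes _     | no y₁≢    | yes _    | yes y≡   =
    contradiction (*-cancelˡ (u ^ 3) (^-≢0 3 u≢0) (trans y≡ (-‿distribʳ-* (u ^ 3) y₂))) y₁≢
  ... | yes refl  | no y₁≢    | yes _    | no _     = sym (trans
    (cong (λ l → chord F l (u ^ 2 * x₁) (u ^ 3 * y₁) (u ^ 2 * x₁)) (begin
      (fromℕ 3 * (u ^ 2 * x₁) ^2 + A E₂) * (fromℕ 2 * (u ^ 3 * y₁)) ⁻¹
        ≡⟨ cong₂ (λ n d → n * d ⁻¹)
             (trans (cong (fromℕ 3 * (u ^ 2 * x₁) ^2 +_) A≡) (numerator u x₁ (A E₁) (fromℕ 3)))
             (denominator u y₁ (fromℕ 2)) ⟩
      (u ^ 3 * u * (fromℕ 3 * x₁ ^2 + A E₁)) * (u ^ 3 * (fromℕ 2 * y₁)) ⁻¹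
        ≡⟨ scale-slope u (u ^ 3) _ _ (^-≢0 3 u≢0) (*-≢0 2≢0 y₁≢0) ⟩
      u * ((fromℕ 3 * x₁ ^2 + A E₁) * (fromℕ 2 * y₁) ⁻¹) ∎))
    (scale-chord u _ x₁ y₁ x₁))
    where
    open ≡-Reasoning
    numerator : ∀ u x a t → t * (u ^ 2 * x) ^2 + u ^ 4 * a ≡ u ^ 3 * u * (t * x ^2 + a)
    numerator = solve 4 (λ u x a t → t :* ((u :^ 2 :* x) :* (u :^ 2 :* x)) :+ u :^ 4 :* a
         := u :^ 3 :* u :* (t :* (x :* x) :+ a)) refl
    denominator : ∀ u y t → t * (u ^ 3 * y) ≡ u ^ 3 * (t * y)
    denominator = solve 3 (λ u y t → t :* (u :^ 3 :* y) := u :^ 3 :* (t :* y)) refl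
    -- Equal abscissas give y₁ = ± y₂; the sign - is excluded by the branch, and y₁ = y₂ = 0 would
    -- again mean y₁ = -y₂.
    y₁≢0 : y₁ ≢ 0#
    y₁≢0 y₁≡0 with x*x≡y*y⇒x≡±y (trans h₁ (sym h₂))
    ... | inj₁ y₁≡y₂  = y₁≢ (trans y₁≡0 (trans (sym -0#≈0#) (cong -_ (trans (sym y₁≡0) y₁≡y₂))))
    ... | inj₂ y₁≡-y₂ = y₁≢ y₁≡-y₂
  scale-addRaw u E₁ E₂ 2≢0 u≢0 A≡ (just (x₁ , y₁)) (just (x₂ , y₂)) h₁ h₂
      | no x₁≢x₂  | _         | no _     | _        = sym (trans
    (cong (λ l → chord F l (u ^ 2 * x₁) (u ^ 3 * y₁) (u ^ 2 * x₂)) (begin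
      (u ^ 3 * y₂ + - (u ^ 3 * y₁)) * (u ^ 2 * x₂ + - (u ^ 2 * x₁)) ⁻¹
        ≡⟨ cong₂ (λ s t → (u ^ 3 * y₂ + s) * (u ^ 2 * x₂ + t) ⁻¹) (-‿distribʳ-* _ y₁) (-‿distribʳ-* _ x₁) ⟩
      (u ^ 3 * y₂ + u ^ 3 * - y₁) * (u ^ 2 * x₂ + u ^ 2 * - x₁) ⁻¹
        ≡⟨ cong₂ (λ n d → n * d ⁻¹) (numerator u y₂ (- y₁)) (sym (distribˡ (u ^ 2) x₂ (- x₁))) ⟩
      (u ^ 2 * u * (y₂ + - y₁)) * (u ^ 2 * (x₂ + - x₁)) ⁻¹
        ≡⟨ scale-slope u (u ^ 2) _ _ (^-≢0 2 u≢0) (λ eq → x₁≢x₂ (sym (x-y≡0⇒x≡y x₂ x₁ eq))) ⟩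
      u * ((y₂ + - y₁) * (x₂ + - x₁) ⁻¹) ∎))
    (scale-chord u _ x₁ y₁ x₂))
    where
    open ≡-Reasoning
    numerator : ∀ u s t → u ^ 3 * s + u ^ 3 * t ≡ u ^ 2 * u * (s + t)
    numerator = solve 3 (λ u s t → u :^ 3 :* s :+ u :^ 3 :* t := u :^ 2 :* u :* (s :+ t)) refl

  scaling⇒GroupIso : ∀ u E₁ E₂ → fromℕ 2 ≢ 0# → u ≢ 0# →
    A E₂ ≡ u ^ 4 * A E₁ → B E₂ ≡ u ^ 6 * B E₁ → GroupIso F E₁ E₂
  scaling⇒GroupIso u E₁ E₂ 2≢0 u≢0 A≡ B≡ =
    ↔⇒⤖ (mk↔ₛ′
      (λ (P , h) → scale u P , scale-onCurve u E₁ E₂ A≡ B≡ P h)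
      (λ (P , h) → scale (u ⁻¹) P , scale-onCurve (u ⁻¹) E₂ E₁
        (inverse-scaling 4 (⁻¹-inverseˡ u u≢0) A≡) (inverse-scaling 6 (⁻¹-inverseˡ u u≢0) B≡) P h)
      (λ (P , _) → point-≡ E₂ (scale-inverse (⁻¹-inverse u u≢0) P))
      (λ (P , _) → point-≡ E₁ (scale-inverse (⁻¹-inverseˡ u u≢0) P)))
    , λ (P , h) (Q , h′) R R≡ → trans (cong (scale u) R≡) (scale-addRaw u E₁ E₂ 2≢0 u≢0 A≡ P Q h h′)

-- Enumerating the points

lookup-injective : ∀ {ℓ} {X : Set ℓ} {xs : List X} → Unique xs → ∀ i j → lookup xs i ≡ lookup xs j → i ≡ j
lookup-injective (_    ∷ _)      zero    zero    _  = refl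
lookup-injective (x∉xs ∷ _)      zero    (suc j) eq = contradiction eq (All.lookup x∉xs (∈-lookup j))
lookup-injective (x∉xs ∷ _)      (suc i) zero    eq = contradiction (sym eq) (All.lookup x∉xs (∈-lookup i))
lookup-injective (_    ∷ unique) (suc i) (suc j) eq = cong suc (lookup-injective unique i j eq)

module Counting (F : FiniteField) where
  open FieldTheory F
  open EllipticCurve

  onAffine? : ∀ E ((x , y) : Carrier × Carrier) → Dec (OnCurve F E (just (x , y)))
  onAffine? E (x , y) = (y ^2) ≟ (x ^3 + A E * x + B E)

  affinePoints : EllipticCurve F → List (Carrier × Carrier)
  affinePoints E = filter (onAffine? E) (cartesianProduct elements elements)

  rawPoints : EllipticCurve F → List (RawPoint F)
  rawPoints E = nothing ∷ map just (affinePoints E)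

  ∈-elements : ∀ x → x ∈ elements
  ∈-elements x = subst (_∈ elements) (strictlyInverseˡ x) (∈-map⁺ to (∈-allFin (from x)))

  rawPoints-unique : ∀ E → Unique (rawPoints E)
  rawPoints-unique E = All.map⁺ (All.tabulate (λ _ ())) ∷
    Unique.map⁺ just-injective (Unique.filter⁺ (onAffine? E)
      (Unique.cartesianProduct⁺ elements-unique elements-unique))

  ∈-rawPoints : ∀ E (P : Point F E) → proj₁ P ∈ rawPoints E
  ∈-rawPoints E (nothing      , _) = here refl
  ∈-rawPoints E (just (x , y) , h) = there (∈-map⁺ just
    (∈-filter⁺ (onAffine? E) (∈-cartesianProduct⁺ (∈-elements x) (∈-elements y)) h))

  rawPoints-sound : ∀ E {P} → P ∈ rawPoints E → OnCurve F E P
  rawPoints-sound E (here refl) = _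
  rawPoints-sound E (there P∈) with ∈-map⁻ just P∈
  ... | _ , Q∈ , refl = proj₂ (∈-filter⁻ (onAffine? E) {xs = cartesianProduct elements elements} Q∈)

  length-filter-row : ∀ E x ys →
    length (filter (onAffine? E) (map (x ,_) ys)) ≡ sum (map (indicator F E x) ys)
  length-filter-row E x []       = refl
  length-filter-row E x (y ∷ ys) with (y ^2) ≟ (x ^3 + A E * x + B E)
  ... | yes _ = cong suc (length-filter-row E x ys)
  ... | no  _ = length-filter-row E x ys

  length-filter-product : ∀ E xs ys →
    length (filter (onAffine? E) (cartesianProduct xs ys)) ≡ sum (map (λ x → sum (map (indicator F E x) ys)) xs)
  length-filter-product E []       ys = refl
  length-filter-product E (x ∷ xs) ys = begin
    length (filter P? (map (x ,_) ys ++ cartesianProduct xs ys))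
      ≡⟨ cong length (filter-++ P? (map (x ,_) ys) _) ⟩
    length (filter P? (map (x ,_) ys) ++ filter P? (cartesianProduct xs ys))
      ≡⟨ length-++ (filter P? (map (x ,_) ys)) ⟩
    length (filter P? (map (x ,_) ys)) ℕ.+ length (filter P? (cartesianProduct xs ys))
      ≡⟨ cong₂ ℕ._+_ (length-filter-row E x ys) (length-filter-product E xs ys) ⟩
    sum (map (indicator F E x) ys) ℕ.+ sum (map (λ x → sum (map (indicator F E x) ys)) xs) ∎
    where
    open ≡-Reasoning
    P? = onAffine? E

  length-rawPoints : ∀ E → length (rawPoints E) ≡ #points F E
  length-rawPoints E = cong suc (begin
    length (map just (affinePoints E))
      ≡⟨ length-map just (affinePoints E) ⟩
    length (affinePoints E)
      ≡⟨ length-filter-product E elements elements ⟩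
    sum (map (λ x → sum (map (indicator F E x) elements)) elements)
      ≡⟨ cong sum (sym (map-∘ (allFin size))) ⟩
    sum (map (λ i → sum (map (indicator F E (to i)) elements)) (allFin size))
      ≡⟨ cong sum (map-cong (λ i → cong sum (sym (map-∘ (allFin size)))) (allFin size)) ⟩
    sum (map (λ i → sum (map (λ j → indicator F E (to i) (to j)) (allFin size))) (allFin size)) ∎)
    where open ≡-Reasoning

  pointAt : ∀ E → Fin (length (rawPoints E)) → Point F E
  pointAt E i = lookup (rawPoints E) i , rawPoints-sound E (∈-lookup i)

  indexOf : ∀ E → Point F E → Fin (length (rawPoints E))
  indexOf E P = index (∈-rawPoints E P)

  pointAt-injective : ∀ E {i j} → pointAt E i ≡ pointAt E j → i ≡ j
  pointAt-injective E {i} {j} eq = lookup-injective (rawPoints-unique E) i j (cong proj₁ eq)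

  pointAt-indexOf : ∀ E P → pointAt E (indexOf E P) ≡ P
  pointAt-indexOf E P = Isomorphism.point-≡ F E (sym (lookup-index (∈-rawPoints E P)))

  -- Links the numerical count with the type of points, through a complete list without repetitions
  -- whose head, the point at infinity, matches the `suc` in `#points`.
  point-↔ : ∀ E → Point F E ↔ Fin (#points F E)
  point-↔ E = subst (λ n → Point F E ↔ Fin n) (length-rawPoints E)
    (mk↔ₛ′ (indexOf E) (pointAt E)
      -- This inverse law follows from the other one because `pointAt` is injective.
      (λ i → pointAt-injective E (pointAt-indexOf E (pointAt E i)))
      (pointAt-indexOf E))

  ⤖⇒#points≡ : ∀ E₁ E₂ → Point F E₁ ⤖ Point F E₂ → #points F E₁ ≡ #points F E₂
  ⤖⇒#points≡ E₁ E₂ φ = ↔⇒≡ (point-↔ E₂ ↔-∘ (⤖⇒↔ φ ↔-∘ ↔-sym (point-↔ E₁)))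

theorem3p3 : (F : FiniteField) (p : ℕ) .{{_ : NonZero p}} →
    Prime p → ¬ (p ≡ 2) → ¬ (p ≡ 3) → HasOrderPrimePower F p →
    (E₁ E₂ : EllipticCurve F) →
    Ordinary F p E₁ → Ordinary F p E₂ →
    jInvariant F E₁ ≡ jInvariant F E₂ →
    (#points F E₁ ≡ #points F E₂) ⇔ GroupIso F E₁ E₂
theorem3p3 F p p-prime p≢2 p≢3 (r , _ , size≡p^r)
  E₁@(mkEC A₁ B₁ ns₁) E₂@(mkEC A₂ B₂ ns₂) ordinary₁ _ j≡ = mk⇔
  (λ #≡ → let (u , u≢0 , A≡ , B≡) = equal-j∧#points⇒scaling A₁ B₁ ns₁ A₂ B₂ ns₂ ordinary₁ j≡ #≡ in
    Isomorphism.scaling⇒GroupIso F u E₁ E₂ 2≢0 u≢0 A≡ B≡)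
  (λ (φ , _) → Counting.⤖⇒#points≡ F E₁ E₂ φ)
  where open Characteristic F p p-prime p≢2 p≢3 r size≡p^r
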